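{- Consider, for step sets $X\subseteq\mathbb{Z}^2\setminus\{O\}$, the following seven implications between properties of $X$: $$\mathrm{CC}\Rightarrow\mathrm{SLC},\quad \mathrm{SLC}\Rightarrow\mathrm{LC},\quad \mathrm{FPP}\Rightarrow\mathrm{BPP},\quad \mathrm{BPP}\Rightarrow\neg\mathrm{IPP},\quad \mathrm{CC}\Rightarrow\mathrm{FPP},\quad \mathrm{SLC}\Rightarrow\mathrm{BPP},\quad \mathrm{LC}\Rightarrow\neg\mathrm{IPP}.$$ (i) All seven implications hold for an arbitrary step set $X\subseteq\mathbb{Z}^2\setminus\{O\}$. (ii) For an arbitrary finite step set $X\subseteq\mathbb{Z}^2\setminus\{O\}$, all seven implications are reversible; that is, the six conditions CC, SLC, LC, FPP, BPP and $\neg$IPP are equivalent for $X$. (iii) In general, none of the seven implications is reversible; that is, for each of the seven implications $P\Rightarrow Q$ there is a step set $X\subseteq\mathbb{Z}^2\setminus\{O\}$ satisfying $Q$ but not $P$.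
   Context: Write $O=(0,0)$ and $\mathbb{N}=\{0,1,2,\ldots\}$. A step set is any subset $X$ of $\mathbb{Z}^2\setminus\{O\}$ (finite or infinite). $\mathcal{F}_X$ is the free monoid on $X$: all words $A_1\cdots A_k$ ($k\in\mathbb{N}$, $A_i\in X$), including the empty word; the length of $w=A_1\cdots A_k$ is $\ell(w)=k$. $\mathcal{A}_X$ is the additive submonoid of $\mathbb{Z}^2$ generated by $X$, and $\alpha_X(A_1\cdots A_k)=A_1+\cdots+A_k$. For $A\in\mathbb{Z}^2$ let $\Pi_X(A)=\{w\in\mathcal{F}_X:\alpha_X(w)=A\}$ and $\pi_X(A)=|\Pi_X(A)|\in\mathbb{N}\cup\{\infty\}$. Finiteness properties: $X$ has the FPP (Finite Paths Property) if $\pi_X(A)<\infty$ for all $A\in\mathcal{A}_X$; the IPP (Infinite Paths Property) if $\pi_X(A)=\infty$ for all $A\in\mathcal{A}_X$; the BPP (Bounded Paths Property) if for every $A\in\mathcal{A}_X$ the set $\{\ell(w):w\in\Pi_X(A)\}$ is finite (has a maximum). $\neg$IPP means that $X$ does not have the IPP. Geometric conditions: a line splits $\mathbb{R}^2$ into two open half-planes, which are opposites of each other. A cone is an intersection of two open half-planes whose bounding lines are not parallel; its vertex is the intersection point of these lines. $X$ satisfies the LC (Line Condition) if it is contained in an open half-plane bounded by a line through $O$; the SLC (Strong Line Condition) if it is contained in an open half-plane whose opposite open half-plane contains $O$; the CC (Cone Condition) if it is contained in a cone with vertex $O$. -}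

module Defs where

open import Data.Integer using (ℤ; 0ℤ)
import Data.Integer as ℤ
open import Data.List using (List; length; foldr)
open import Data.List.Membership.Propositional using () renaming (_∈_ to _∈ˡ_)
open import Data.List.Relation.Unary.All using (All)
open import Data.Nat using (ℕ)
import Data.Nat as ℕ
import Data.Nat.Properties as ℕ
open import Data.Product using (Σ-syntax; ∃; _×_; _,_)
open import Data.Rational
  using (ℚ; 0ℚ; 1ℚ; ½; _<_; _≤_; _+_; _-_; -_; _*_; 1/_; _/_; ∣_∣;
         Positive; NonZero; positive; nonNegative)
open import Data.Rational.Properties
open import Data.Rational.Solver using (module +-*-Solver)
open import Data.Sum using (_⊎_)
open import Level using (0ℓ)
open import Relation.Binary.PropositionalEquality
  using (_≡_; refl; sym; trans; cong; subst)
open import Relation.Nullary using (¬_)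
open import Relation.Unary using (Pred; _∈_; _∉_; _⊆_; _≐_)

-- Real numbers are Cauchy sequences of rationals; equality of reals is _≃ᴿ_.

IsCauchy : (ℕ → ℚ) → Set
IsCauchy s = ∀ ε → 0ℚ < ε →
  Σ[ N ∈ ℕ ] (∀ m n → N ℕ.≤ m → N ℕ.≤ n → ∣ s m - s n ∣ < ε)

record ℝ : Set where
  constructor mkℝ
  field
    seq    : ℕ → ℚ
    cauchy : IsCauchy seq

open ℝ public

infix  4 _<ᴿ_ _≃ᴿ_ _#ᴿ_
infixl 6 _+ᴿ_
infixl 7 _*ᴿ_

_<ᴿ_ : ℝ → ℝ → Set
x <ᴿ y = Σ[ ε ∈ ℚ ] (0ℚ < ε ×
  Σ[ N ∈ ℕ ] (∀ n → N ℕ.≤ n → seq x n + ε ≤ seq y n))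

_≃ᴿ_ : ℝ → ℝ → Set
x ≃ᴿ y = ∀ ε → 0ℚ < ε →
  Σ[ N ∈ ℕ ] (∀ n → N ℕ.≤ n → ∣ seq x n - seq y n ∣ < ε)

-- Apartness, the constructive form of x ≠ y.
_#ᴿ_ : ℝ → ℝ → Set
x #ᴿ y = (x <ᴿ y) ⊎ (y <ᴿ x)

constᴿ : ℚ → ℝ
constᴿ q = mkℝ (λ _ → q) λ ε 0<ε →
  0 , λ _ _ _ _ → subst (_< ε) (cong ∣_∣ (sym (+-inverseʳ q))) 0<ε

fromℤ : ℤ → ℝ
fromℤ z = constᴿ (z / 1)

0ᴿ : ℝ
0ᴿ = fromℤ 0ℤ

abstract
  half-pos : ∀ {ε} → 0ℚ < ε → 0ℚ < ε * ½
  half-pos {ε} 0<ε = subst (_< ε * ½) (*-zeroˡ ½) (*-monoˡ-<-pos ½ 0<ε)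

  halves : ∀ ε → ε * ½ + ε * ½ ≡ ε
  halves ε = trans (sym (*-distribˡ-+ ε ½ ½)) (*-identityʳ ε)

  sum-split : ∀ a b c d → (a + b) - (c + d) ≡ (a - c) + (b - d)
  sum-split = solve 4 (λ a b c d →
    (a :+ b) :- (c :+ d) := (a :- c) :+ (b :- d)) refl
    where open +-*-Solver

  product-split : ∀ a b c d → a * b - c * d ≡ a * (b - d) + d * (a - c)
  product-split = solve 4 (λ a b c d →
    a :* b :- c :* d := a :* (b :- d) :+ d :* (a :- c)) refl
    where open +-*-Solver

  around : ∀ a b → a ≡ b + (a - b)
  around = solve 2 (λ a b → a := b :+ (a :- b)) refl
    where open +-*-Solver

  -- Every Cauchy sequence has a tail bounded by a positive rational.
  tail-bound : ∀ x → Σ[ N ∈ ℕ ] Σ[ B ∈ ℚ ]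
    (0ℚ < B × (∀ n → N ℕ.≤ n → ∣ seq x n ∣ ≤ B))
  tail-bound x with cauchy x 1ℚ (positive⁻¹ 1ℚ)
  ... | N , close = N , ∣ seq x N ∣ + 1ℚ
    , +-mono-≤-< (0≤∣p∣ (seq x N)) (positive⁻¹ 1ℚ)
    , λ n N≤n → begin
        ∣ seq x n ∣
          ≡⟨ cong ∣_∣ (around (seq x n) (seq x N)) ⟩
        ∣ seq x N + (seq x n - seq x N) ∣
          ≤⟨ ∣p+q∣≤∣p∣+∣q∣ (seq x N) (seq x n - seq x N) ⟩
        ∣ seq x N ∣ + ∣ seq x n - seq x N ∣
          ≤⟨ +-monoʳ-≤ ∣ seq x N ∣ (<⇒≤ (close n N N≤n ℕ.≤-refl)) ⟩
        ∣ seq x N ∣ + 1ℚ ∎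
    where open ≤-Reasoning

  -- If ∣ p ∣ ≤ B and ∣ r ∣ < δ with B > 0, then ∣ p * r ∣ < B * δ.
  product-bound : ∀ p r {B δ} → 0ℚ < B → ∣ p ∣ ≤ B → ∣ r ∣ < δ → ∣ p * r ∣ < B * δ
  product-bound p r {B} {δ} 0<B p≤B r<δ = begin-strict
    ∣ p * r ∣      ≡⟨ ∣p*q∣≡∣p∣*∣q∣ p r ⟩
    ∣ p ∣ * ∣ r ∣  ≤⟨ *-monoʳ-≤-nonNeg ∣ r ∣ {{nonNegative (0≤∣p∣ r)}} p≤B ⟩
    B * ∣ r ∣      <⟨ *-monoʳ-<-pos B {{positive 0<B}} r<δ ⟩
    B * δ          ∎
    where open ≤-Reasoning

  quotient : ∀ {ε D} → 0ℚ < ε → 0ℚ < D → Σ[ δ ∈ ℚ ] (0ℚ < δ × D * δ ≡ ε)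
  quotient {ε} {D} 0<ε 0<D = δ , 0<δ , D*δ≡ε
    where
    instance
      D-pos : Positive D
      D-pos = positive 0<D
      D-nonZero : NonZero D
      D-nonZero = pos⇒nonZero D
    inv : ℚ
    inv = 1/ D
    inv≡ : D * inv ≡ 1ℚ
    inv≡ = *-inverseʳ D
    0<inv : 0ℚ < inv
    0<inv = positive⁻¹ inv {{1/pos⇒pos D}}
    δ : ℚ
    δ = inv * ε
    0<δ : 0ℚ < δ
    0<δ = subst (_< δ) (*-zeroʳ inv) (*-monoʳ-<-pos inv {{positive 0<inv}} 0<ε)
    D*δ≡ε : D * δ ≡ ε
    D*δ≡ε = trans (sym (*-assoc D inv ε)) (trans (cong (_* ε) inv≡) (*-identityˡ ε))

  sum-bound : ∀ a b c d {δ η} → ∣ a - c ∣ < δ → ∣ b - d ∣ < η →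
              ∣ (a + b) - (c + d) ∣ < δ + η
  sum-bound a b c d {δ} {η} p q = begin-strict
    ∣ (a + b) - (c + d) ∣    ≡⟨ cong ∣_∣ (sum-split a b c d) ⟩
    ∣ (a - c) + (b - d) ∣    ≤⟨ ∣p+q∣≤∣p∣+∣q∣ (a - c) (b - d) ⟩
    ∣ a - c ∣ + ∣ b - d ∣    <⟨ +-mono-< p q ⟩
    δ + η                    ∎
    where open ≤-Reasoning

  difference-bound : ∀ a b c d {B C δ} → 0ℚ < B → 0ℚ < C → ∣ a ∣ ≤ B → ∣ d ∣ ≤ C →
                     ∣ b - d ∣ < δ → ∣ a - c ∣ < δ → ∣ a * b - c * d ∣ < (B + C) * δ
  difference-bound a b c d {B} {C} {δ} 0<B 0<C a≤B d≤C p q = begin-strict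
    ∣ a * b - c * d ∣
      ≡⟨ cong ∣_∣ (product-split a b c d) ⟩
    ∣ a * (b - d) + d * (a - c) ∣
      ≤⟨ ∣p+q∣≤∣p∣+∣q∣ (a * (b - d)) (d * (a - c)) ⟩
    ∣ a * (b - d) ∣ + ∣ d * (a - c) ∣
      <⟨ +-mono-< (product-bound a (b - d) 0<B a≤B p) (product-bound d (a - c) 0<C d≤C q) ⟩
    B * δ + C * δ
      ≡⟨ sym (*-distribʳ-+ δ B C) ⟩
    (B + C) * δ ∎
    where open ≤-Reasoning

  +-cauchy : ∀ x y → IsCauchy (λ n → seq x n + seq y n)
  +-cauchy x y ε 0<ε =
    let M , cx = cauchy x (ε * ½) (half-pos 0<ε)
        N , cy = cauchy y (ε * ½) (half-pos 0<ε)
    in M ℕ.⊔ N , λ m n m≥ n≥ →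
       subst (∣ (seq x m + seq y m) - (seq x n + seq y n) ∣ <_) (halves ε)
         (sum-bound (seq x m) (seq y m) (seq x n) (seq y n)
           (cx m n (ℕ.m⊔n≤o⇒m≤o M N m≥) (ℕ.m⊔n≤o⇒m≤o M N n≥))
           (cy m n (ℕ.m⊔n≤o⇒n≤o M N m≥) (ℕ.m⊔n≤o⇒n≤o M N n≥)))

  *-cauchy : ∀ x y → IsCauchy (λ n → seq x n * seq y n)
  *-cauchy x y ε 0<ε =
    let K , B , 0<B , bx = tail-bound x
        L , C , 0<C , by = tail-bound y
        δ , 0<δ , eq     = quotient {ε} {B + C} 0<ε (+-mono-< 0<B 0<C)
        M , cx           = cauchy x δ 0<δ
        N , cy           = cauchy y δ 0<δ
    in (K ℕ.⊔ L) ℕ.⊔ (M ℕ.⊔ N) , λ m n m≥ n≥ →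
       let m≥KL = ℕ.m⊔n≤o⇒m≤o (K ℕ.⊔ L) (M ℕ.⊔ N) m≥
           n≥KL = ℕ.m⊔n≤o⇒m≤o (K ℕ.⊔ L) (M ℕ.⊔ N) n≥
           m≥MN = ℕ.m⊔n≤o⇒n≤o (K ℕ.⊔ L) (M ℕ.⊔ N) m≥
           n≥MN = ℕ.m⊔n≤o⇒n≤o (K ℕ.⊔ L) (M ℕ.⊔ N) n≥
       in subst (∣ seq x m * seq y m - seq x n * seq y n ∣ <_) eq
            (difference-bound (seq x m) (seq y m) (seq x n) (seq y n) 0<B 0<C
              (bx m (ℕ.m⊔n≤o⇒m≤o K L m≥KL))
              (by n (ℕ.m⊔n≤o⇒n≤o K L n≥KL))
              (cy m n (ℕ.m⊔n≤o⇒n≤o M N m≥MN) (ℕ.m⊔n≤o⇒n≤o M N n≥MN))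
              (cx m n (ℕ.m⊔n≤o⇒m≤o M N m≥MN) (ℕ.m⊔n≤o⇒m≤o M N n≥MN)))

_+ᴿ_ : ℝ → ℝ → ℝ
x +ᴿ y = mkℝ (λ n → seq x n + seq y n) (+-cauchy x y)

_*ᴿ_ : ℝ → ℝ → ℝ
x *ᴿ y = mkℝ (λ n → seq x n * seq y n) (*-cauchy x y)

ℤ² : Set
ℤ² = ℤ × ℤ

O : ℤ²
O = 0ℤ , 0ℤ

infixl 6 _⊕_

_⊕_ : ℤ² → ℤ² → ℤ²
(a , b) ⊕ (c , d) = (a ℤ.+ c) , (b ℤ.+ d)

record StepSet : Set₁ where
  field
    Step   : Pred ℤ² 0ℓ
    O∉Step : O ∉ Step

open StepSet public

-- The free monoid on X, as the lists of lattice points all of whose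
-- entries lie in X; two words are equal when they are equal as lists, so
-- different proofs of membership in X are not counted separately.
𝓕 : StepSet → Pred (List ℤ²) 0ℓ
𝓕 X = All (Step X)

data 𝓐 (X : StepSet) : Pred ℤ² 0ℓ where
  gen  : ∀ {A} → A ∈ Step X → A ∈ 𝓐 X
  nil  : O ∈ 𝓐 X
  add  : ∀ {A B} → A ∈ 𝓐 X → B ∈ 𝓐 X → (A ⊕ B) ∈ 𝓐 X

α : List ℤ² → ℤ²
α = foldr _⊕_ O

Π : StepSet → ℤ² → Pred (List ℤ²) 0ℓ
Π X A w = w ∈ 𝓕 X × α w ≡ A

-- S = {x₁, …, xₙ}.
Finite : {T : Set} → Pred T 0ℓ → Set
Finite S = ∃ λ xs → S ≐ (_∈ˡ xs)

-- S ⊆ {x₁, …, xₙ}.  Classically the same as Finite S.  It is the notion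
-- used for sets of words and of lengths: listing such a set exactly would
-- amount to deciding membership in an arbitrary step set.
Subfinite : {T : Set} → Pred T 0ℓ → Set
Subfinite S = ∃ λ xs → S ⊆ (_∈ˡ xs)

Infinite : {T : Set} → Pred T 0ℓ → Set
Infinite S = ¬ Subfinite S

lengths : StepSet → ℤ² → Pred ℕ 0ℓ
lengths X A n = ∃ λ w → w ∈ Π X A × length w ≡ n

FPP : StepSet → Set
FPP X = ∀ A → A ∈ 𝓐 X → Subfinite (Π X A)

IPP : StepSet → Set
IPP X = ∀ A → A ∈ 𝓐 X → Infinite (Π X A)

BPP : StepSet → Set
BPP X = ∀ A → A ∈ 𝓐 X → Subfinite (lengths X A)

ℝ² : Set
ℝ² = ℝ × ℝ

ι : ℤ² → ℝ²
ι (p , q) = fromℤ p , fromℤ q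

-- The line a x + b y = c with a chosen side a x + b y > c.  Every open
-- half-plane is of this form: to obtain the other side of the same line,
-- replace (a , b , c) by (- a , - b , - c).
record HalfPlane : Set where
  field
    a b c         : ℝ
    nondegenerate : (a #ᴿ 0ᴿ) ⊎ (b #ᴿ 0ᴿ)

  form : ℝ² → ℝ
  form (x , y) = a *ᴿ x +ᴿ b *ᴿ y

  Inside : Pred ℝ² 0ℓ
  Inside P = c <ᴿ form P

  Boundary : Pred ℝ² 0ℓ
  Boundary P = form P ≃ᴿ c

  Opposite : Pred ℝ² 0ℓ
  Opposite P = form P <ᴿ c

open HalfPlane public using (Inside; Boundary; Opposite)

NonParallel : HalfPlane → HalfPlane → Set
NonParallel H K = (a H *ᴿ b K) #ᴿ (a K *ᴿ b H)
  where open HalfPlane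

record Cone : Set where
  field
    H₁ H₂       : HalfPlane
    nonParallel : NonParallel H₁ H₂

  InCone : Pred ℝ² 0ℓ
  InCone P = P ∈ Inside H₁ × P ∈ Inside H₂

  IsVertex : Pred ℝ² 0ℓ
  IsVertex P = P ∈ Boundary H₁ × P ∈ Boundary H₂

open Cone public using (InCone; IsVertex)

infix 4 _⊆ᴿ_

_⊆ᴿ_ : StepSet → Pred ℝ² 0ℓ → Set
X ⊆ᴿ R = ∀ A → A ∈ Step X → ι A ∈ R

LC : StepSet → Set
LC X = Σ[ H ∈ HalfPlane ] (ι O ∈ Boundary H × X ⊆ᴿ Inside H)

SLC : StepSet → Set
SLC X = Σ[ H ∈ HalfPlane ] (ι O ∈ Opposite H × X ⊆ᴿ Inside H)

CC : StepSet → Set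
CC X = Σ[ C ∈ Cone ] (ι O ∈ IsVertex C × X ⊆ᴿ InCone C)

{-# OPTIONS --safe #-}
module Submission where

-- The conditions are compared through an integral form of CC: some integer vector h
-- satisfies h ∙ A ≥ ∣ A ∣₁ for every step A.  A real cone gives such an h because the
-- sum of its two forms is bounded below by a positive multiple of the norm, which
-- survives rational approximation; conversely h can be tilted into two forms spanning
-- a cone.  Such an h bounds both the length and the letters of every path to A, hence
-- CC ⇒ FPP, and SLC, LC bound lengths and exclude zero sums in the same way.
--
-- For finite X everything reduces to ¬IPP ⇒ CC.  Gordan's alternative for a list of
-- nonzero plane vectors decides between a nonempty word with sum O, which can be
-- inserted any number of times into any path and so gives IPP, and a vector h with
-- h ∙ A > 0 for all steps, a multiple of which is the integral form of CC.
--
-- Three step sets separate the properties: the lattice line y = 1 (SLC, not FPP), the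
-- half-plane of an irrational line through O (LC; not BPP, because a fixed point is a
-- large multiple of a good convergent plus another step), and the parabola x = y²,
-- y ≥ 1, together with (-1 , 0) (FPP, not LC).

open import Defs
open import Data.Product using (_×_; Σ-syntax)
open import Function.Bundles using (_⇔_)
open import Relation.Nullary using (¬_)
open import Data.Empty using (⊥-elim)
open import Data.Integer using (ℤ; +_; -[1+_]; 0ℤ; 1ℤ)
import Data.Integer as ℤ
import Data.Integer.Properties as ℤ
open import Data.Integer.Tactic.RingSolver using (solve-∀)
open import Data.List using (List; []; _∷_; _++_; length; map; replicate; cartesianProductWith; upTo)
open import Data.List.Membership.Propositional using (find; lose) renaming (_∈_ to _∈ˡ_)
open import Data.List.Membership.Propositional.Properties
  using (∈-map⁺; ∈-++⁺ˡ; ∈-++⁺ʳ; ∈-cartesianProductWith⁺; ∈-upTo⁺)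
open import Data.List.Properties using (length-++; length-replicate)
open import Data.List.Relation.Unary.All using (All; []; _∷_; lookup; tabulate)
import Data.List.Relation.Unary.All as All
import Data.List.Relation.Unary.All.Properties as All
open import Data.List.Relation.Unary.Any using (here; there; any?)
open import Data.Nat using (ℕ; zero; suc; z≤n; s≤s)
import Data.Nat as ℕ
open import Data.Nat.ListAction using (sum)
import Data.Nat.Properties as ℕ
open import Data.Product using (∃; _,_; proj₁; proj₂)
open import Data.Rational
  using (ℚ; 0ℚ; 1ℚ; ½; _<_; _≤_; _+_; _-_; -_; _*_; _/_; ∣_∣; ↥_; ↧_; toℚᵘ; positive; nonNegative)
open import Data.Rational.Properties
open import Data.Rational.Solver using (module +-*-Solver)
import Data.Rational.Unnormalised as ℚᵘ
import Data.Rational.Unnormalised.Properties as ℚᵘ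
open import Data.Sum using (_⊎_; inj₁; inj₂)
import Data.Sum as Sum
open import Function using (_∘_; flip; id; mk⇔)
open import Level using (0ℓ)
open import Relation.Binary.Core using (Rel)
open import Relation.Binary.Definitions using (Reflexive; Transitive; tri<; tri≈; tri>)
open import Relation.Binary.PropositionalEquality
open import Relation.Nullary using (yes; no; contradiction)
open import Relation.Unary using (Pred; _∈_)

-- Words and path counts

⊕-assoc : ∀ A B C → (A ⊕ B) ⊕ C ≡ A ⊕ (B ⊕ C)
⊕-assoc (a , b) (c , d) (e , f) = cong₂ _,_ (ℤ.+-assoc a c e) (ℤ.+-assoc b d f)

⊕-identityˡ : ∀ A → O ⊕ A ≡ A
⊕-identityˡ (a , b) = cong₂ _,_ (ℤ.+-identityˡ a) (ℤ.+-identityˡ b)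

⊕-identityʳ : ∀ A → A ⊕ O ≡ A
⊕-identityʳ (a , b) = cong₂ _,_ (ℤ.+-identityʳ a) (ℤ.+-identityʳ b)

α-++ : ∀ u v → α (u ++ v) ≡ α u ⊕ α v
α-++ []      v = sym (⊕-identityˡ (α v))
α-++ (A ∷ u) v = trans (cong (A ⊕_) (α-++ u v)) (sym (⊕-assoc A (α u) (α v)))

infixl 7 _·_ _∙_

_·_ : ℤ → ℤ² → ℤ²
k · (x , y) = k ℤ.* x , k ℤ.* y

α-replicate : ∀ n A → α (replicate n A) ≡ + n · A
α-replicate zero    (x , y) = refl
α-replicate (suc n) (x , y) rewrite α-replicate n (x , y) = cong₂ _,_ (step x) (step y)
  where
  step : ∀ z → z ℤ.+ + n ℤ.* z ≡ + suc n ℤ.* z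
  step z = sym (ℤ.suc-* (+ n) z)

_∙_ : ℤ² → ℤ² → ℤ
(a , b) ∙ (x , y) = a ℤ.* x ℤ.+ b ℤ.* y

∙-⊕ : ∀ h A B → h ∙ (A ⊕ B) ≡ h ∙ A ℤ.+ h ∙ B
∙-⊕ (a , b) (x , y) (z , w) = lemma a b x y z w
  where
  lemma : ∀ a b x y z w → a ℤ.* (x ℤ.+ z) ℤ.+ b ℤ.* (y ℤ.+ w)
                        ≡ (a ℤ.* x ℤ.+ b ℤ.* y) ℤ.+ (a ℤ.* z ℤ.+ b ℤ.* w)
  lemma = solve-∀

∙-O : ∀ h → h ∙ O ≡ 0ℤ
∙-O (a , b) = cong₂ ℤ._+_ (ℤ.*-zeroʳ a) (ℤ.*-zeroʳ b)

∃word : ∀ {X A} → A ∈ 𝓐 X → ∃ (_∈ Π X A)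
∃word {A = A} (gen A∈X) = A ∷ [] , A∈X ∷ [] , ⊕-identityʳ A
∃word nil = [] , [] , refl
∃word (add A∈ B∈) =
  let u , u∈ , αu = ∃word A∈
      v , v∈ , αv = ∃word B∈
  in u ++ v , All.++⁺ u∈ v∈ , trans (α-++ u v) (cong₂ _⊕_ αu αv)

Subfinite⇒bounded : ∀ {T : Set} {S : Pred T 0ℓ} (m : T → ℕ) →
  Subfinite S → Σ[ N ∈ ℕ ] (∀ {x} → x ∈ S → m x ℕ.≤ N)
Subfinite⇒bounded m (xs , S⊆xs) = sum (map m xs) , λ x∈S → m≤sum (S⊆xs x∈S)
  where
  m≤sum : ∀ {x xs} → x ∈ˡ xs → m x ℕ.≤ sum (map m xs)
  m≤sum (here refl) = ℕ.m≤m+n _ _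
  m≤sum (there x∈)  = ℕ.≤-trans (m≤sum x∈) (ℕ.m≤n+m _ _)

unbounded⇒Infinite : ∀ {T : Set} {S : Pred T 0ℓ} (m : T → ℕ) →
  (∀ n → ∃ λ x → x ∈ S × n ℕ.≤ m x) → Infinite S
unbounded⇒Infinite m large fin =
  let N , bound    = Subfinite⇒bounded m fin
      x , x∈S , N< = large (suc N)
  in ℕ.<-irrefl refl (ℕ.≤-trans N< (bound x∈S))

bounded⇒Subfinite : ∀ {S : Pred ℕ 0ℓ} N → (∀ {n} → n ∈ S → n ℕ.≤ N) → Subfinite S
bounded⇒Subfinite N bound = upTo (suc N) , λ n∈S → ∈-upTo⁺ (s≤s (bound n∈S))

FPP⇒BPP : ∀ X → FPP X → BPP X
FPP⇒BPP X fpp A A∈ =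
  let ws , Π⊆ws = fpp A A∈
  in map length ws , λ { (w , w∈Π , refl) → ∈-map⁺ length (Π⊆ws w∈Π) }

pump : ℕ → List ℤ² → List ℤ²
pump zero    z = []
pump (suc n) z = z ++ pump n z

α-pump : ∀ z → α z ≡ O → ∀ n → α (pump n z) ≡ O
α-pump z αz≡O zero    = refl
α-pump z αz≡O (suc n) = trans (α-++ z (pump n z)) (cong₂ _⊕_ αz≡O (α-pump z αz≡O n))

length-pump : ∀ A z n → n ℕ.≤ length (pump n (A ∷ z))
length-pump A z zero    = z≤n
length-pump A z (suc n) = s≤s (subst (n ℕ.≤_) (sym (length-++ z {pump n (A ∷ z)}))
  (ℕ.≤-trans (length-pump A z n) (ℕ.m≤n+m _ (length z))))

All-pump : ∀ {P : Pred ℤ² 0ℓ} z → All P z → ∀ n → All P (pump n z)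
All-pump z all zero    = []
All-pump z all (suc n) = All.++⁺ all (All-pump z all n)

-- Writing the word as `B ∷ z` builds in that it is nonempty, so its `n`-fold repetition has length
-- at least `n` and `length` is unbounded on the paths to `A`.
zeroSum⇒IPP : ∀ {X} B z → (B ∷ z) ∈ Π X O → IPP X
zeroSum⇒IPP {X} B z (z∈ , αz) A A∈ = unbounded⇒Infinite length λ n →
  let w , w∈ , αw = ∃word A∈
  in pump n (B ∷ z) ++ w
   , ( All.++⁺ (All-pump (B ∷ z) z∈ n) w∈
     , trans (α-++ (pump n (B ∷ z)) w)
         (trans (cong₂ _⊕_ (α-pump (B ∷ z) αz n) αw) (⊕-identityˡ A)))
   , ℕ.≤-trans (length-pump B z n)
       (subst (length (pump n (B ∷ z)) ℕ.≤_) (sym (length-++ (pump n (B ∷ z)))) (ℕ.m≤m+n _ _))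

-- `O` lies in every `𝓐 X`, and without nonempty zero sums its only path is the empty word, so IPP
-- already fails at `O`.
noZeroSum⇒¬IPP : ∀ {X} → (∀ B z → ¬ ((B ∷ z) ∈ Π X O)) → ¬ IPP X
noZeroSum⇒¬IPP none ipp = ipp O nil
  ([] ∷ [] , λ { {[]} _ → here refl ; {B ∷ z} z∈ → ⊥-elim (none B z z∈) })

-- Only the lengths at `O` matter: a nonempty zero sum could be repeated there to give arbitrarily
-- long paths.
BPP⇒¬IPP : ∀ X → BPP X → ¬ IPP X
BPP⇒¬IPP X bpp = noZeroSum⇒¬IPP {X} λ B z (z∈ , αz) →
  unbounded⇒Infinite id
    (λ n → length (pump n (B ∷ z))
         , (pump n (B ∷ z) , (All-pump (B ∷ z) z∈ n , α-pump (B ∷ z) αz n) , refl)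
         , length-pump B z n)
    (bpp O nil)

-- Integral forms dominating the norm, and finiteness of path sets

norm : ℤ² → ℕ
norm (x , y) = ℤ.∣ x ∣ ℕ.+ ℤ.∣ y ∣

norm>0 : ∀ {v} → v ≢ O → 1 ℕ.≤ norm v
norm>0 {x , y} v≢O = ℕ.n≢0⇒n>0 λ norm≡0 → v≢O (cong₂ _,_
  (ℤ.∣i∣≡0⇒i≡0 (ℕ.m+n≡0⇒m≡0 _ norm≡0))
  (ℤ.∣i∣≡0⇒i≡0 (ℕ.m+n≡0⇒n≡0 ℤ.∣ x ∣ norm≡0)))

-- The factor 1 in front of the norm is a normalisation: a lower bound by any positive multiple of
-- the norm becomes this one after scaling `h`, and the condition stays within the integers.
Coercive : ℤ² → Pred ℤ² 0ℓ
Coercive h v = + norm v ℤ.≤ h ∙ v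

StrongCoercive : ℤ² → Pred ℤ² 0ℓ
StrongCoercive h v = v ≢ O × Coercive h v

i≤+∣i∣ : ∀ i → i ℤ.≤ + ℤ.∣ i ∣
i≤+∣i∣ (+ n)    = ℤ.≤-refl
i≤+∣i∣ -[1+ n ] = ℤ.-≤+

-∣i∣≤i : ∀ i → ℤ.- (+ ℤ.∣ i ∣) ℤ.≤ i
-∣i∣≤i (+ zero)  = ℤ.≤-refl
-∣i∣≤i (+ suc n) = ℤ.-≤+
-∣i∣≤i -[1+ n ]  = ℤ.≤-refl

∣i∣≤n⇒i≡±k : ∀ {i n} → ℤ.∣ i ∣ ℕ.≤ n → ∃ λ k → k ℕ.≤ n × (i ≡ + k ⊎ i ≡ ℤ.- + k)
∣i∣≤n⇒i≡±k {+ k}      k≤n = k , k≤n , inj₁ refl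
∣i∣≤n⇒i≡±k { -[1+ k ]} k≤n = suc k , k≤n , inj₂ refl

interval : ℕ → List ℤ
interval n = map +_ (upTo (suc n)) ++ map (λ k → ℤ.- + k) (upTo (suc n))

∈-interval : ∀ {i n} → ℤ.∣ i ∣ ℕ.≤ n → i ∈ˡ interval n
∈-interval {i} {n} ∣i∣≤n with ∣i∣≤n⇒i≡±k {i} ∣i∣≤n
... | k , k≤n , inj₁ refl = ∈-++⁺ˡ (∈-map⁺ +_ (∈-upTo⁺ (s≤s k≤n)))
... | k , k≤n , inj₂ refl = ∈-++⁺ʳ (map +_ (upTo (suc n)))
  (∈-map⁺ (λ k → ℤ.- + k) (∈-upTo⁺ (s≤s k≤n)))

box : ℕ → List ℤ²
box n = cartesianProductWith _,_ (interval n) (interval n)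

∈-box : ∀ {v n} → norm v ℕ.≤ n → v ∈ˡ box n
∈-box {x , y} v≤n = ∈-cartesianProductWith⁺ _,_
  (∈-interval (ℕ.≤-trans (ℕ.m≤m+n _ _) v≤n))
  (∈-interval (ℕ.≤-trans (ℕ.m≤n+m _ _) v≤n))

words : {T : Set} → List T → ℕ → List (List T)
words xs zero    = [] ∷ []
words xs (suc n) = [] ∷ cartesianProductWith _∷_ xs (words xs n)

∈-words : ∀ {T : Set} {xs : List T} {w n} → All (_∈ˡ xs) w → length w ℕ.≤ n → w ∈ˡ words xs n
∈-words {n = zero}  []        _         = here refl
∈-words {n = suc n} []        _         = here refl
∈-words {n = suc n} (A∈ ∷ w∈) (s≤s w≤n) =
  there (∈-cartesianProductWith⁺ _∷_ A∈ (∈-words w∈ w≤n))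

weight : List ℤ² → ℕ
weight w = sum (map norm w)

coercive-weight : ∀ h w → All (Coercive h) w → + weight w ℤ.≤ h ∙ α w
coercive-weight h []      []        = ℤ.≤-reflexive (sym (∙-O h))
coercive-weight h (A ∷ w) (cA ∷ cw) =
  subst (+ weight (A ∷ w) ℤ.≤_) (sym (∙-⊕ h A (α w))) (ℤ.+-mono-≤ cA (coercive-weight h w cw))

length≤weight : ∀ {w} → All (_≢ O) w → length w ℕ.≤ weight w
length≤weight []           = z≤n
length≤weight (v≢O ∷ w≢O) = ℕ.+-mono-≤ (norm>0 v≢O) (length≤weight w≢O)

All-norm≤weight : ∀ w → All (λ v → norm v ℕ.≤ weight w) w
All-norm≤weight []      = []
All-norm≤weight (v ∷ w) = ℕ.m≤m+n _ _ ∷ All.map (λ v≤ → ℕ.≤-trans v≤ (ℕ.m≤n+m _ _)) (All-norm≤weight w)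

-- Summing coercivity over the letters bounds the weight of `w` by `h ∙ A`. This bounds the norm of
-- each letter, and also the length because nonzero letters have norm at least 1. The condition is
-- on the letters of `w` and not on a step set, so that `h` may depend on `A`, as it must for the
-- parabola.
coercive⇒Subfinite : ∀ h A → Subfinite (λ w → All (StrongCoercive h) w × α w ≡ A)
coercive⇒Subfinite h A = words (box N) N , λ { {w} (cw , refl) →
  let weight≤N : weight w ℕ.≤ N
      weight≤N = ℤ.drop‿+≤+ (ℤ.≤-trans (coercive-weight h w (All.map proj₂ cw)) (i≤+∣i∣ (h ∙ α w)))
  in ∈-words (All.map (λ v≤ → ∈-box (ℕ.≤-trans v≤ weight≤N)) (All-norm≤weight w))
             (ℕ.≤-trans (length≤weight (All.map proj₁ cw)) weight≤N) }
  where
  N = ℤ.∣ h ∙ A ∣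

Step≢O : ∀ X {A} → A ∈ Step X → A ≢ O
Step≢O X A∈X refl = O∉Step X A∈X

CoerciveOn : StepSet → Set
CoerciveOn X = ∃ λ h → ∀ A → A ∈ Step X → Coercive h A

coercive⇒FPP : ∀ X → CoerciveOn X → FPP X
coercive⇒FPP X (h , coercive) A _ =
  let ws , ⊆ws = coercive⇒Subfinite h A
  in ws , λ { {w} (w∈ , αw) → ⊆ws (All.map (λ {v} v∈ → Step≢O X v∈ , coercive v v∈) w∈ , αw) }

-- Gordan's alternative in the plane

det : ℤ² → ℤ² → ℤ
det (a , b) (c , d) = a ℤ.* d ℤ.- b ℤ.* c

plücker : ∀ u v w → det v w · u ⊕ det w u · v ⊕ det u v · w ≡ O
plücker (a , b) (c , d) (e , f) = cong₂ _,_ (fst a b c d e f) (snd a b c d e f)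
  where
  fst : ∀ a b c d e f → (c ℤ.* f ℤ.- d ℤ.* e) ℤ.* a ℤ.+ (e ℤ.* b ℤ.- f ℤ.* a) ℤ.* c
      ℤ.+ (a ℤ.* d ℤ.- b ℤ.* c) ℤ.* e ≡ 0ℤ
  fst = solve-∀
  snd : ∀ a b c d e f → (c ℤ.* f ℤ.- d ℤ.* e) ℤ.* b ℤ.+ (e ℤ.* b ℤ.- f ℤ.* a) ℤ.* d
      ℤ.+ (a ℤ.* d ℤ.- b ℤ.* c) ℤ.* f ≡ 0ℤ
  snd = solve-∀

∙-plücker : ∀ g u v w → det v w ℤ.* (g ∙ u) ℤ.+ det w u ℤ.* (g ∙ v) ℤ.+ det u v ℤ.* (g ∙ w) ≡ 0ℤ
∙-plücker (p , q) (a , b) (c , d) (e , f) = lemma p q a b c d e f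
  where
  lemma : ∀ p q a b c d e f →
    (c ℤ.* f ℤ.- d ℤ.* e) ℤ.* (p ℤ.* a ℤ.+ q ℤ.* b) ℤ.+ (e ℤ.* b ℤ.- f ℤ.* a) ℤ.* (p ℤ.* c ℤ.+ q ℤ.* d)
      ℤ.+ (a ℤ.* d ℤ.- b ℤ.* c) ℤ.* (p ℤ.* e ℤ.+ q ℤ.* f) ≡ 0ℤ
  lemma = solve-∀

-- The left side is `det u v` times the vector `(q , - p)` perpendicular to `g = (p , q)`. Its
-- coefficients are nonnegative when `g` is positive at `v` and not at `u`.
parallel : ∀ g u v → det u v ≡ 0ℤ → (g ∙ v) · u ⊕ (ℤ.- (g ∙ u)) · v ≡ O
parallel (p , q) (a , b) (c , d) det≡0 = cong₂ _,_
  (trans (fst p q a b c d) (vanish q)) (trans (snd p q a b c d) (vanish (ℤ.- p)))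
  where
  vanish : ∀ k → k ℤ.* (a ℤ.* d ℤ.- b ℤ.* c) ≡ 0ℤ
  vanish k = trans (cong (k ℤ.*_) det≡0) (ℤ.*-zeroʳ k)
  fst : ∀ p q a b c d → (p ℤ.* c ℤ.+ q ℤ.* d) ℤ.* a ℤ.+ (ℤ.- (p ℤ.* a ℤ.+ q ℤ.* b)) ℤ.* c
      ≡ q ℤ.* (a ℤ.* d ℤ.- b ℤ.* c)
  fst = solve-∀
  snd : ∀ p q a b c d → (p ℤ.* c ℤ.+ q ℤ.* d) ℤ.* b ℤ.+ (ℤ.- (p ℤ.* a ℤ.+ q ℤ.* b)) ℤ.* d
      ≡ (ℤ.- p) ℤ.* (a ℤ.* d ℤ.- b ℤ.* c)
  snd = solve-∀

-- A positive integer `f x` is at least 1, so every multiplier above `∣ g x ∣` works at `x`; adding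
-- the bounds along the list keeps the earlier ones valid. It serves both to tilt a form and to pass
-- from positivity to coercivity.
dominate : ∀ {T : Set} (f g : T → ℤ) {xs} → All (λ x → 0ℤ ℤ.< f x) xs →
  Σ[ k ∈ ℕ ] All (λ x → g x ℤ.< + k ℤ.* f x) xs
dominate f g []                = 0 , []
dominate f g {x ∷ xs} (0<fx ∷ 0<f) =
  let k , g<kf = dominate f g 0<f
      n = k ℕ.+ suc ℤ.∣ g x ∣
  in n , ( (let open ℤ.≤-Reasoning in begin-strict
             g x                       ≤⟨ i≤+∣i∣ (g x) ⟩
             + ℤ.∣ g x ∣               <⟨ ℤ.+<+ ℕ.≤-refl ⟩
             + suc ℤ.∣ g x ∣           ≤⟨ ℤ.+≤+ (ℕ.m≤n+m _ k) ⟩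
             + n                       ≡⟨ sym (ℤ.*-identityʳ (+ n)) ⟩
             + n ℤ.* 1ℤ                ≤⟨ ℤ.*-monoˡ-≤-nonNeg (+ n) (ℤ.i<j⇒suc[i]≤j 0<fx) ⟩
             + n ℤ.* f x               ∎)
         ∷ All.zipWith (λ {y} (0<fy , g<) → ℤ.<-≤-trans g<
             (ℤ.*-monoʳ-≤-nonNeg (f y) {{ℤ.nonNegative (ℤ.<⇒≤ 0<fy)}} (ℤ.+≤+ (ℕ.m≤m+n k _))))
             (0<f , g<kf))

ZeroSum : List ℤ² → Set
ZeroSum xs = ∃ λ B → ∃ λ z → All (_∈ˡ xs) (B ∷ z) × α (B ∷ z) ≡ O

Separated : List ℤ² → Set
Separated xs = ∃ λ h → All (λ v → 0ℤ ℤ.< h ∙ v) xs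

zeroSum : ∀ {xs w B} → B ∈ˡ w → All (_∈ˡ xs) w → α w ≡ O → ZeroSum xs
zeroSum {w = B ∷ z} _ w∈ αw = B , z , w∈ , αw

α-replicate-nonNeg : ∀ {c} → 0ℤ ℤ.≤ c → ∀ A → α (replicate ℤ.∣ c ∣ A) ≡ c · A
α-replicate-nonNeg {c} 0≤c A =
  trans (α-replicate ℤ.∣ c ∣ A) (cong (_· A) (ℤ.0≤i⇒+∣i∣≡i 0≤c))

∈-replicate : ∀ {c} → 0ℤ ℤ.< c → ∀ (A : ℤ²) → A ∈ˡ replicate ℤ.∣ c ∣ A
∈-replicate {+ suc n} _ A = here refl
∈-replicate {+ zero} (ℤ.+<+ ()) A

-- The coefficients become repetition counts of letters; the strictly positive one makes the
-- resulting word nonempty.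
combination₂ : ∀ {xs u v c d} → u ∈ˡ xs → v ∈ˡ xs → 0ℤ ℤ.< c → 0ℤ ℤ.≤ d →
  c · u ⊕ d · v ≡ O → ZeroSum xs
combination₂ {u = u} {v} {c} {d} u∈ v∈ 0<c 0≤d sum≡O = zeroSum
  (∈-++⁺ˡ (∈-replicate 0<c u))
  (All.++⁺ (All.replicate⁺ ℤ.∣ c ∣ u∈) (All.replicate⁺ ℤ.∣ d ∣ v∈))
  (trans (α-++ (replicate ℤ.∣ c ∣ u) (replicate ℤ.∣ d ∣ v))
    (trans (cong₂ _⊕_ (α-replicate-nonNeg (ℤ.<⇒≤ 0<c) u) (α-replicate-nonNeg 0≤d v)) sum≡O))

combination₃ : ∀ {xs u v w c d e} → u ∈ˡ xs → v ∈ˡ xs → w ∈ˡ xs →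
  0ℤ ℤ.≤ c → 0ℤ ℤ.≤ d → 0ℤ ℤ.< e → c · u ⊕ d · v ⊕ e · w ≡ O → ZeroSum xs
combination₃ {u = u} {v} {w} {c} {d} {e} u∈ v∈ w∈ 0≤c 0≤d 0<e sum≡O = zeroSum
  (∈-++⁺ʳ (cu ++ dv) (∈-replicate 0<e w))
  (All.++⁺ (All.++⁺ (All.replicate⁺ ℤ.∣ c ∣ u∈) (All.replicate⁺ ℤ.∣ d ∣ v∈)) (All.replicate⁺ ℤ.∣ e ∣ w∈))
  (trans (α-++ (cu ++ dv) ew)
    (trans (cong₂ _⊕_ (trans (α-++ cu dv) (cong₂ _⊕_ (α-replicate-nonNeg 0≤c u) (α-replicate-nonNeg 0≤d v)))
                       (α-replicate-nonNeg (ℤ.<⇒≤ 0<e) w))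
           sum≡O))
  where
  cu = replicate ℤ.∣ c ∣ u
  dv = replicate ℤ.∣ d ∣ v
  ew = replicate ℤ.∣ e ∣ w

rot rot⁻¹ : ℤ² → ℤ²
rot   (x , y) = ℤ.- y , x
rot⁻¹ (x , y) = y , ℤ.- x

rot-∙ : ∀ u v → rot u ∙ v ≡ det u v
rot-∙ (a , b) (c , d) = lemma a b c d
  where
  lemma : ∀ a b c d → (ℤ.- b) ℤ.* c ℤ.+ a ℤ.* d ≡ a ℤ.* d ℤ.- b ℤ.* c
  lemma = solve-∀

rot⁻¹-∙ : ∀ u v → rot⁻¹ u ∙ v ≡ det v u
rot⁻¹-∙ (a , b) (c , d) = lemma a b c d
  where
  lemma : ∀ a b c d → b ℤ.* c ℤ.+ (ℤ.- a) ℤ.* d ≡ c ℤ.* b ℤ.- d ℤ.* a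
  lemma = solve-∀

det-self : ∀ v → det v v ≡ 0ℤ
det-self (a , b) = lemma a b
  where
  lemma : ∀ a b → a ℤ.* b ℤ.- b ℤ.* a ≡ 0ℤ
  lemma = solve-∀

det-anti : ∀ u v → det u v ≡ ℤ.- det v u
det-anti (a , b) (c , d) = lemma a b c d
  where
  lemma : ∀ a b c d → a ℤ.* d ℤ.- b ℤ.* c ≡ ℤ.- (c ℤ.* b ℤ.- d ℤ.* a)
  lemma = solve-∀

0<-det : ∀ u v → det u v ℤ.< 0ℤ → 0ℤ ℤ.< det v u
0<-det u v det<0 = subst (0ℤ ℤ.<_) (sym (det-anti v u)) (ℤ.neg-mono-< det<0)

·⊕-∙ : ∀ k g h v → (k · g ⊕ h) ∙ v ≡ k ℤ.* (g ∙ v) ℤ.+ h ∙ v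
·⊕-∙ k (a , b) (c , d) (x , y) = lemma k a b c d x y
  where
  lemma : ∀ k a b c d x y → (k ℤ.* a ℤ.+ c) ℤ.* x ℤ.+ (k ℤ.* b ℤ.+ d) ℤ.* y
    ≡ k ℤ.* (a ℤ.* x ℤ.+ b ℤ.* y) ℤ.+ (c ℤ.* x ℤ.+ d ℤ.* y)
  lemma = solve-∀

0≤i*i : ∀ i → 0ℤ ℤ.≤ i ℤ.* i
0≤i*i i = subst (0ℤ ℤ.≤_) (square i) (ℤ.+≤+ z≤n)
  where
  square : ∀ i → + (ℤ.∣ i ∣ ℕ.* ℤ.∣ i ∣) ≡ i ℤ.* i
  square (+ n)    = ℤ.pos-* n n
  square -[1+ n ] = refl

v∙v>0 : ∀ {v} → v ≢ O → 0ℤ ℤ.< v ∙ v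
v∙v>0 {+ zero   , + zero}   v≢O = contradiction refl v≢O
v∙v>0 {+ zero   , + suc n}  v≢O = ℤ.+<+ (s≤s z≤n)
v∙v>0 {+ zero   , -[1+ n ]} v≢O = ℤ.+<+ (s≤s z≤n)
v∙v>0 {+ suc m  , y}        v≢O = ℤ.+-mono-<-≤ {0ℤ} {+ suc m ℤ.* + suc m} (ℤ.+<+ (s≤s z≤n)) (0≤i*i y)
v∙v>0 { -[1+ m ] , y}       v≢O = ℤ.+-mono-<-≤ {0ℤ} { -[1+ m ] ℤ.* -[1+ m ]} (ℤ.+<+ (s≤s z≤n)) (0≤i*i y)

-- The witness is k j + v for large k: j decides on vs, and v itself at v, where j vanishes.
separate : ∀ j {v vs} → v ≢ O → j ∙ v ≡ 0ℤ → All (λ u → 0ℤ ℤ.< j ∙ u) vs → Separated (v ∷ vs)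
separate j {v} {vs} v≢O j∙v≡0 0<j =
  let k , big = dominate (j ∙_) (λ u → ℤ.- (v ∙ u)) 0<j
  in + k · j ⊕ v , atHead k ∷ All.map (λ {u} → atTail k u) big
  where
  atHead : ∀ k → 0ℤ ℤ.< (+ k · j ⊕ v) ∙ v
  atHead k = subst (0ℤ ℤ.<_)
    (sym (trans (·⊕-∙ (+ k) j v v)
      (trans (cong (λ t → + k ℤ.* t ℤ.+ v ∙ v) j∙v≡0)
        (trans (cong (ℤ._+ v ∙ v) (ℤ.*-zeroʳ (+ k))) (ℤ.+-identityˡ (v ∙ v))))))
    (v∙v>0 v≢O)
  atTail : ∀ k u → ℤ.- (v ∙ u) ℤ.< + k ℤ.* (j ∙ u) → 0ℤ ℤ.< (+ k · j ⊕ v) ∙ u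
  atTail k u lt = subst₂ ℤ._<_ (ℤ.+-inverseˡ (v ∙ u)) (sym (·⊕-∙ (+ k) j v u)) (ℤ.+-monoˡ-< (v ∙ u) lt)

-- When the form g separating vs fails at v, the signs of det v on vs decide: a zero gives
-- a vector antiparallel to v, two opposite signs give a zero sum by the Plücker relation,
-- and a constant sign lets a rotation of v separate.
gordan : ∀ xs → All (_≢ O) xs → ZeroSum xs ⊎ Separated xs
gordan []       []            = inj₂ (O , [])
gordan (v ∷ vs) (v≢O ∷ vs≢O) with gordan vs vs≢O
... | inj₁ (B , z , z∈ , αz) = inj₁ (B , z , All.map there z∈ , αz)
... | inj₂ (g , 0<g) with 0ℤ ℤ.<? g ∙ v
...   | yes 0<g∙v = inj₂ (g , 0<g∙v ∷ 0<g)
...   | no  0≮g∙v with any? (λ u → det v u ℤ.≟ 0ℤ) vs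
...     | yes some = let u , u∈ , det≡0 = find some in inj₁
          (combination₂ (here refl) (there u∈) (lookup 0<g u∈) (ℤ.neg-mono-≤ (ℤ.≮⇒≥ 0≮g∙v))
            (parallel g v u det≡0))
...     | no none with any? (λ u → 0ℤ ℤ.<? det v u) vs | any? (λ u → det v u ℤ.<? 0ℤ) vs
...       | no none⁺ | _ = inj₂ (separate (rot⁻¹ v) v≢O (trans (rot⁻¹-∙ v v) (det-self v))
            (tabulate λ {u} u∈ → subst (0ℤ ℤ.<_) (sym (rot⁻¹-∙ v u)) (0<-det v u
              (ℤ.≤∧≢⇒< (ℤ.≮⇒≥ (λ 0<det → none⁺ (lose u∈ 0<det))) (λ det≡0 → none (lose u∈ det≡0))))))
...       | _ | no none⁻ = inj₂ (separate (rot v) v≢O (trans (rot-∙ v v) (det-self v))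
            (tabulate λ {u} u∈ → subst (0ℤ ℤ.<_) (sym (rot-∙ v u))
              (ℤ.≤∧≢⇒< (ℤ.≮⇒≥ (λ det<0 → none⁻ (lose u∈ det<0))) (λ 0≡det → none (lose u∈ (sym 0≡det))))))
...       | yes some⁺ | yes some⁻ =
            let u , u∈ , 0<det = find some⁺
                w , w∈ , det<0 = find some⁻
                0<wv = 0<-det v w det<0
            in inj₁ (combination₃ (here refl) (there u∈) (there w∈)
                 (coefficient v u w (ℤ.≮⇒≥ 0≮g∙v) (lookup 0<g u∈) (lookup 0<g w∈) 0<wv 0<det)
                 (ℤ.<⇒≤ 0<wv) 0<det (plücker v u w))
  where
  -- Pairing the Plücker relation with g fixes the sign of its first coefficient.
  coefficient : ∀ v u w → g ∙ v ℤ.≤ 0ℤ → 0ℤ ℤ.< g ∙ u → 0ℤ ℤ.< g ∙ w →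
    0ℤ ℤ.< det w v → 0ℤ ℤ.< det v u → 0ℤ ℤ.≤ det u w
  coefficient v u w gv≤0 0<gu 0<gw 0<wv 0<vu = ℤ.≮⇒≥ λ uw<0 →
    ℤ.<-irrefl (sym (∙-plücker g v u w))
      (ℤ.+-mono-< (ℤ.+-mono-≤-< (nonPos*nonPos (ℤ.<⇒≤ uw<0) gv≤0) (pos*pos 0<wv 0<gu)) (pos*pos 0<vu 0<gw))
    where
    pos*pos : ∀ {i j} → 0ℤ ℤ.< i → 0ℤ ℤ.< j → 0ℤ ℤ.< i ℤ.* j
    pos*pos {i} {j} 0<i 0<j = subst (ℤ._< i ℤ.* j) (ℤ.*-zeroʳ i)
      (ℤ.*-monoˡ-<-pos i {{ℤ.positive 0<i}} 0<j)
    nonPos*nonPos : ∀ {i j} → i ℤ.≤ 0ℤ → j ℤ.≤ 0ℤ → 0ℤ ℤ.≤ i ℤ.* j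
    nonPos*nonPos {i} {j} i≤0 j≤0 = subst (ℤ._≤ i ℤ.* j) (ℤ.*-zeroʳ i)
      (ℤ.*-monoˡ-≤-nonPos i {{ℤ.nonPositive i≤0}} j≤0)

finite∧¬IPP⇒coercive : ∀ {X} → Finite (Step X) → ¬ IPP X → CoerciveOn X
finite∧¬IPP⇒coercive {X} (xs , X⊆xs , xs⊆X) ¬ipp
  with gordan xs (tabulate λ v∈ → Step≢O X (xs⊆X v∈))
... | inj₁ (B , z , z∈ , αz) = contradiction (zeroSum⇒IPP {X} B z (All.map xs⊆X z∈ , αz)) ¬ipp
... | inj₂ (h , 0<h) =
  let k , big = dominate (h ∙_) (λ v → + norm v) 0<h
  in + k · h , λ A A∈X → subst (+ norm A ℤ.≤_) (sym (scale (+ k) h A)) (ℤ.<⇒≤ (lookup big (X⊆xs A∈X)))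
  where
  scale : ∀ k h v → (k · h) ∙ v ≡ k ℤ.* (h ∙ v)
  scale k (a , b) (x , y) = lemma k a b x y
    where
    lemma : ∀ k a b x y → k ℤ.* a ℤ.* x ℤ.+ k ℤ.* b ℤ.* y ≡ k ℤ.* (a ℤ.* x ℤ.+ b ℤ.* y)
    lemma = solve-∀

-- The integers inside the rationals

toℚ : ℤ → ℚ
toℚ z = z / 1

-- `z / 1` normalises by a gcd, which does not reduce for a variable `z`. The ring and order laws
-- are therefore transported from the unnormalised rationals, where the fraction is literal.
toℚᵘ-toℚ : ∀ z → toℚᵘ (toℚ z) ℚᵘ.≃ ℚᵘ.mkℚᵘ z 0
toℚᵘ-toℚ z = toℚᵘ-fromℚᵘ (ℚᵘ.mkℚᵘ z 0)

toℚ-+ : ∀ x y → toℚ (x ℤ.+ y) ≡ toℚ x + toℚ y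
toℚ-+ x y = toℚᵘ-injective (begin
  toℚᵘ (toℚ (x ℤ.+ y))                   ≈⟨ toℚᵘ-toℚ (x ℤ.+ y) ⟩
  ℚᵘ.mkℚᵘ (x ℤ.+ y) 0                    ≈⟨ ℚᵘ.*≡* (lemma x y) ⟩
  ℚᵘ.mkℚᵘ x 0 ℚᵘ.+ ℚᵘ.mkℚᵘ y 0           ≈⟨ ℚᵘ.+-cong (ℚᵘ.≃-sym (toℚᵘ-toℚ x)) (ℚᵘ.≃-sym (toℚᵘ-toℚ y)) ⟩
  toℚᵘ (toℚ x) ℚᵘ.+ toℚᵘ (toℚ y)         ≈⟨ ℚᵘ.≃-sym (toℚᵘ-homo-+ (toℚ x) (toℚ y)) ⟩
  toℚᵘ (toℚ x + toℚ y)                   ∎)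
  where
  open ℚᵘ.≃-Reasoning
  lemma : ∀ x y → (x ℤ.+ y) ℤ.* 1ℤ ≡ (x ℤ.* 1ℤ ℤ.+ y ℤ.* 1ℤ) ℤ.* 1ℤ
  lemma = solve-∀

toℚ-* : ∀ x y → toℚ (x ℤ.* y) ≡ toℚ x * toℚ y
toℚ-* x y = toℚᵘ-injective (begin
  toℚᵘ (toℚ (x ℤ.* y))                   ≈⟨ toℚᵘ-toℚ (x ℤ.* y) ⟩
  ℚᵘ.mkℚᵘ x 0 ℚᵘ.* ℚᵘ.mkℚᵘ y 0           ≈⟨ ℚᵘ.*-cong (ℚᵘ.≃-sym (toℚᵘ-toℚ x)) (ℚᵘ.≃-sym (toℚᵘ-toℚ y)) ⟩
  toℚᵘ (toℚ x) ℚᵘ.* toℚᵘ (toℚ y)         ≈⟨ ℚᵘ.≃-sym (toℚᵘ-homo-* (toℚ x) (toℚ y)) ⟩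
  toℚᵘ (toℚ x * toℚ y)                   ∎)
  where open ℚᵘ.≃-Reasoning

toℚ-mono-≤ : ∀ {x y} → x ℤ.≤ y → toℚ x ≤ toℚ y
toℚ-mono-≤ {x} {y} x≤y = toℚᵘ-cancel-≤
  (ℚᵘ.≤-respˡ-≃ (ℚᵘ.≃-sym (toℚᵘ-toℚ x)) (ℚᵘ.≤-respʳ-≃ (ℚᵘ.≃-sym (toℚᵘ-toℚ y))
    (ℚᵘ.*≤* (ℤ.*-monoʳ-≤-nonNeg 1ℤ x≤y))))

toℚ-mono-< : ∀ {x y} → x ℤ.< y → toℚ x < toℚ y
toℚ-mono-< {x} {y} x<y = toℚᵘ-cancel-<
  (ℚᵘ.<-respˡ-≃ (ℚᵘ.≃-sym (toℚᵘ-toℚ x)) (ℚᵘ.<-respʳ-≃ (ℚᵘ.≃-sym (toℚᵘ-toℚ y))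
    (ℚᵘ.*<* (ℤ.*-monoʳ-<-pos 1ℤ x<y))))

toℚ-cancel-≤ : ∀ {x y} → toℚ x ≤ toℚ y → x ℤ.≤ y
toℚ-cancel-≤ {x} {y} x≤y = ℤ.≮⇒≥ λ y<x → <-irrefl refl (<-≤-trans (toℚ-mono-< y<x) x≤y)

toℚ-neg : ∀ x → toℚ (ℤ.- x) ≡ - toℚ x
toℚ-neg x = begin
  toℚ (ℤ.- x)                       ≡⟨ rearrange (toℚ (ℤ.- x)) (toℚ x) ⟩
  toℚ (ℤ.- x) + toℚ x - toℚ x       ≡⟨ cong (_- toℚ x) (sym (toℚ-+ (ℤ.- x) x)) ⟩
  toℚ (ℤ.- x ℤ.+ x) - toℚ x         ≡⟨ cong (λ z → toℚ z - toℚ x) (ℤ.+-inverseˡ x) ⟩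
  0ℚ - toℚ x                        ≡⟨ +-identityˡ (- toℚ x) ⟩
  - toℚ x                           ∎
  where
  open ≡-Reasoning
  rearrange : ∀ p q → p ≡ p + q - q
  rearrange = solve 2 (λ p q → p := p :+ q :- q) refl
    where open +-*-Solver

toℚ-∣∣ : ∀ x → toℚ (+ ℤ.∣ x ∣) ≡ ∣ toℚ x ∣
toℚ-∣∣ (+ n)    = sym (0≤p⇒∣p∣≡p (toℚ-mono-≤ {0ℤ} {+ n} (ℤ.+≤+ z≤n)))
toℚ-∣∣ -[1+ n ] = begin
  toℚ (+ suc n)       ≡⟨ toℚ-∣∣ (+ suc n) ⟩
  ∣ toℚ (+ suc n) ∣   ≡⟨ sym (∣-p∣≡∣p∣ (toℚ (+ suc n))) ⟩
  ∣ - toℚ (+ suc n) ∣ ≡⟨ cong ∣_∣ (sym (toℚ-neg (+ suc n))) ⟩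
  ∣ toℚ -[1+ n ] ∣    ∎
  where open ≡-Reasoning

toℚ-↥ : ∀ p → toℚ (↧ p) * p ≡ toℚ (↥ p)
toℚ-↥ p@record{} = toℚᵘ-injective (begin
  toℚᵘ (toℚ (↧ p) * p)                   ≈⟨ toℚᵘ-homo-* (toℚ (↧ p)) p ⟩
  toℚᵘ (toℚ (↧ p)) ℚᵘ.* toℚᵘ p           ≈⟨ ℚᵘ.*-congʳ {toℚᵘ p} (toℚᵘ-toℚ (↧ p)) ⟩
  ℚᵘ.mkℚᵘ (↧ p) 0 ℚᵘ.* toℚᵘ p            ≈⟨ ℚᵘ.*≡* (lemma (↥ p) (↧ p)) ⟩
  ℚᵘ.mkℚᵘ (↥ p) 0                        ≈⟨ ℚᵘ.≃-sym (toℚᵘ-toℚ (↥ p)) ⟩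
  toℚᵘ (toℚ (↥ p))                       ∎)
  where
  open ℚᵘ.≃-Reasoning
  lemma : ∀ n d → (d ℤ.* n) ℤ.* 1ℤ ≡ n ℤ.* (1ℤ ℤ.* d)
  lemma = solve-∀

0<1 : 0ℚ < 1ℚ
0<1 = positive⁻¹ 1ℚ

0<* : ∀ {p q} → 0ℚ < p → 0ℚ < q → 0ℚ < p * q
0<* {p} {q} 0<p 0<q = subst (_< p * q) (*-zeroʳ p) (*-monoʳ-<-pos p {{positive 0<p}} 0<q)

*-monoˡ : ∀ {p q} r → 0ℚ ≤ r → p ≤ q → r * p ≤ r * q
*-monoˡ r 0≤r = *-monoˡ-≤-nonNeg r {{nonNegative 0≤r}}

*-monoʳ : ∀ {p q} r → 0ℚ ≤ r → p ≤ q → p * r ≤ q * r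
*-monoʳ r 0≤r = *-monoʳ-≤-nonNeg r {{nonNegative 0≤r}}

p≤∣p∣ : ∀ p → p ≤ ∣ p ∣
p≤∣p∣ p with ≤-total 0ℚ p
... | inj₁ 0≤p = ≤-reflexive (sym (0≤p⇒∣p∣≡p 0≤p))
... | inj₂ p≤0 = ≤-trans p≤0 (0≤∣p∣ p)

-- Here `K = ε * δ`, and `δ` is at most the absolute value of its numerator because its denominator
-- is at least 1.
archimedean : ∀ {K ε} → 0ℚ < K → 0ℚ < ε → Σ[ M ∈ ℕ ] K ≤ toℚ (+ M) * ε
archimedean {K} {ε} 0<K 0<ε with quotient {K} {ε} 0<K 0<ε
... | δ , 0<δ , refl = ℤ.∣ ↥ δ ∣ , subst (ε * δ ≤_) (*-comm ε _) (*-monoˡ ε (<⇒≤ 0<ε) (begin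
    δ                    ≡⟨ sym (*-identityˡ δ) ⟩
    1ℚ * δ               ≤⟨ *-monoʳ δ (<⇒≤ 0<δ) (toℚ-mono-≤ {1ℤ} {↧ δ} (ℤ.+≤+ (s≤s z≤n))) ⟩
    toℚ (↧ δ) * δ        ≡⟨ toℚ-↥ δ ⟩
    toℚ (↥ δ)            ≤⟨ p≤∣p∣ _ ⟩
    ∣ toℚ (↥ δ) ∣        ≡⟨ sym (toℚ-∣∣ (↥ δ)) ⟩
    toℚ (+ ℤ.∣ ↥ δ ∣)    ∎))
  where open ≤-Reasoning

-- Half-planes and cones

-- Order, equality and bounds of reals are statements about tails, so finitely many of them hold
-- together from some index on; evaluating there leaves rational inequalities at a single index.
Eventually : (ℕ → Set) → Set
Eventually P = Σ[ N ∈ ℕ ] (∀ n → N ℕ.≤ n → P n)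

eventually-map : ∀ {P Q : ℕ → Set} → (∀ n → P n → Q n) → Eventually P → Eventually Q
eventually-map f (N , P) = N , λ n N≤n → f n (P n N≤n)

eventually-map₂ : ∀ {P Q R : ℕ → Set} → (∀ n → P n → Q n → R n) →
  Eventually P → Eventually Q → Eventually R
eventually-map₂ f (M , P) (N , Q) = M ℕ.⊔ N , λ n M⊔N≤n →
  f n (P n (ℕ.m⊔n≤o⇒m≤o M N M⊔N≤n)) (Q n (ℕ.m⊔n≤o⇒n≤o M N M⊔N≤n))

eventually⇒∃ : ∀ {P : ℕ → Set} → Eventually P → ∃ P
eventually⇒∃ (N , P) = N , P N ℕ.≤-refl

eventually-bounded : ∀ x → Σ[ B ∈ ℚ ] (0ℚ < B × Eventually (λ n → ∣ seq x n ∣ ≤ B))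
eventually-bounded x = let N , B , 0<B , bound = tail-bound x in B , 0<B , N , bound

linear : ℚ → ℚ → ℤ² → ℚ
linear a b (x , y) = a * toℚ x + b * toℚ y

value : HalfPlane → ℕ → ℤ² → ℚ
value H n = linear (seq (HalfPlane.a H) n) (seq (HalfPlane.b H) n)

linear-O : ∀ a b → linear a b O ≡ 0ℚ
linear-O a b = cong₂ _+_ (*-zeroʳ a) (*-zeroʳ b)

linear-⊕ : ∀ a b A B → linear a b (A ⊕ B) ≡ linear a b A + linear a b B
linear-⊕ a b (x , y) (z , w) rewrite toℚ-+ x z | toℚ-+ y w =
  solve 6 (λ a b x y z w → a :* (x :+ z) :+ b :* (y :+ w)
                        := (a :* x :+ b :* y) :+ (a :* z :+ b :* w)) refl
    a b (toℚ x) (toℚ y) (toℚ z) (toℚ w)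
  where open +-*-Solver

linear-toℚ : ∀ p q A → linear (toℚ p) (toℚ q) A ≡ toℚ ((p , q) ∙ A)
linear-toℚ p q (x , y) = sym (trans (toℚ-+ (p ℤ.* x) (q ℤ.* y)) (cong₂ _+_ (toℚ-* p x) (toℚ-* q y)))

value-O : ∀ H n → value H n O ≡ 0ℚ
value-O H n = linear-O (seq (HalfPlane.a H) n) (seq (HalfPlane.b H) n)

value-⊕ : ∀ H n A B → value H n (A ⊕ B) ≡ value H n A + value H n B
value-⊕ H n = linear-⊕ (seq (HalfPlane.a H) n) (seq (HalfPlane.b H) n)

-- Additivity is exact at each index, and the finitely many letters share a tail on which all their
-- bounds hold. With `t` positive this bounds lengths; with `t = 0` it gives nonnegativity of the
-- sum.
value-α : ∀ H t w → All (λ A → Eventually (λ n → t ≤ value H n A)) w →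
  Eventually (λ n → toℚ (+ length w) * t ≤ value H n (α w))
value-α H t []      []        = 0 , λ n _ → ≤-reflexive (trans (*-zeroˡ t) (sym (value-O H n)))
value-α H t (A ∷ w) (tA ∷ tw) = eventually-map₂ step tA (value-α H t w tw)
  where
  step : ∀ n → t ≤ value H n A → toℚ (+ length w) * t ≤ value H n (α w) →
    toℚ (+ suc (length w)) * t ≤ value H n (A ⊕ α w)
  step n t≤ kt≤ = begin
    toℚ (+ suc (length w)) * t       ≡⟨ cong (_* t) (toℚ-+ 1ℤ (+ length w)) ⟩
    (1ℚ + toℚ (+ length w)) * t      ≡⟨ *-distribʳ-+ t 1ℚ (toℚ (+ length w)) ⟩
    1ℚ * t + toℚ (+ length w) * t    ≡⟨ cong (_+ toℚ (+ length w) * t) (*-identityˡ t) ⟩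
    t + toℚ (+ length w) * t         ≤⟨ +-mono-≤ t≤ kt≤ ⟩
    value H n A + value H n (α w)    ≡⟨ sym (value-⊕ H n A (α w)) ⟩
    value H n (A ⊕ α w)              ∎
    where open ≤-Reasoning

-- `O` lies below the threshold `c` by `ε` and the steps lie above it, so the margin of `O` serves
-- for all steps at once; only the index from which it holds depends on `A`.
SLC-uniform : ∀ X ((H , _) : SLC X) →
  Σ[ ε ∈ ℚ ] (0ℚ < ε × (∀ A → A ∈ Step X → Eventually (λ n → ε ≤ value H n A)))
SLC-uniform X (H , (ε , 0<ε , below) , inside) = ε , 0<ε , λ A@(_ , _) A∈X →
  let δ , 0<δ , above = inside A A∈X
  in eventually-map₂ (λ n ε≤c c+δ≤ → begin
       ε                                   ≡⟨ sym (+-identityˡ ε) ⟩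
       0ℚ + ε                              ≡⟨ cong (_+ ε) (sym (value-O H n)) ⟩
       value H n O + ε                     ≤⟨ ε≤c ⟩
       seq (HalfPlane.c H) n               ≡⟨ sym (+-identityʳ (seq (HalfPlane.c H) n)) ⟩
       seq (HalfPlane.c H) n + 0ℚ          ≤⟨ +-monoʳ-≤ (seq (HalfPlane.c H) n) (<⇒≤ 0<δ) ⟩
       seq (HalfPlane.c H) n + δ           ≤⟨ c+δ≤ ⟩
       value H n A                         ∎)
       below above
  where open ≤-Reasoning

SLC⇒BPP : ∀ X → SLC X → BPP X
SLC⇒BPP X slc@(H , _) A@(_ , _) _ with SLC-uniform X slc | eventually-bounded (HalfPlane.form H (ι A))
... | ε , 0<ε , uniform | B , 0<B , bounded with archimedean {B} {ε} 0<B 0<ε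
...   | M , B≤Mε = bounded⇒Subfinite M λ { (w , (w∈ , αw) , refl) →
  -- The index `n` may depend on the word, whereas `M` was fixed from `A` and `ε` beforehand.
  let n , lε≤ , ≤B = eventually⇒∃ (eventually-map₂ (λ _ → _,_)
                       (value-α H ε w (All.map (λ {A} → uniform A) w∈)) bounded)
      open ≤-Reasoning
  in ℤ.drop‿+≤+ (toℚ-cancel-≤ (*-cancelʳ-≤-pos ε {{positive 0<ε}} (begin
       toℚ (+ length w) * ε     ≤⟨ lε≤ ⟩
       value H n (α w)          ≡⟨ cong (value H n) αw ⟩
       value H n A              ≤⟨ p≤∣p∣ (value H n A) ⟩
       ∣ value H n A ∣          ≤⟨ ≤B ⟩
       B                        ≤⟨ B≤Mε ⟩
       toℚ (+ M) * ε            ∎))) }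

-- `O` on the boundary makes the terms of `c` tend to 0 without vanishing. Half of the gap `δ` pays
-- for that error and the other half survives.
boundary-inside : ∀ H A → ι O ∈ Boundary H → ι A ∈ Inside H →
  Σ[ ε ∈ ℚ ] (0ℚ < ε × Eventually (λ n → ε ≤ value H n A))
boundary-inside H A@(_ , _) O∈ (δ , 0<δ , above) = δ * ½ , half-pos 0<δ ,
  eventually-map₂ (λ n close c+δ≤ →
    let c = seq (HalfPlane.c H) n
        open ≤-Reasoning
        -c≤ : - c ≤ δ * ½
        -c≤ = begin
          - c                          ≡⟨ sym (+-identityˡ (- c)) ⟩
          0ℚ - c                       ≡⟨ cong (_- c) (sym (value-O H n)) ⟩
          value H n O - c              ≤⟨ p≤∣p∣ (value H n O - c) ⟩
          ∣ value H n O - c ∣          ≤⟨ <⇒≤ close ⟩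
          δ * ½                        ∎
    in begin
      δ * ½                            ≡⟨ rearrange (δ * ½) c ⟩
      c + (δ * ½ + - c)                ≤⟨ +-monoʳ-≤ c (+-monoʳ-≤ (δ * ½) -c≤) ⟩
      c + (δ * ½ + δ * ½)              ≡⟨ cong (_+_ c) (halves δ) ⟩
      c + δ                            ≤⟨ c+δ≤ ⟩
      value H n A                      ∎)
    (O∈ (δ * ½) (half-pos 0<δ)) above
  where
  rearrange : ∀ h c → h ≡ c + (h + - c)
  rearrange = solve 2 (λ h c → h := c :+ (h :+ :- c)) refl
    where open +-*-Solver

LC⇒¬IPP : ∀ X → LC X → ¬ IPP X
LC⇒¬IPP X (H , O∈ , inside) = noZeroSum⇒¬IPP {X} λ { B z (B∈ ∷ z∈ , αz) →
  let ε , 0<ε , ε≤B = boundary-inside H B O∈ (inside B B∈)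
      -- LC gives no margin common to all steps. One strict letter suffices: `B` contributes `ε`,
      -- the others are only counted as nonnegative.
      0≤z = value-α H 0ℚ z (All.map (λ {A} A∈ →
              let δ , 0<δ , δ≤A = boundary-inside H A O∈ (inside A A∈)
              in eventually-map (λ n δ≤ → ≤-trans (<⇒≤ 0<δ) δ≤) δ≤A) z∈)
      n , ε≤ , 0≤ = eventually⇒∃ (eventually-map₂ (λ _ → _,_) ε≤B 0≤z)
      open ≤-Reasoning
  in <-irrefl refl (begin-strict
       0ℚ                               <⟨ 0<ε ⟩
       ε                                ≡⟨ sym (+-identityʳ ε) ⟩
       ε + 0ℚ                           ≡⟨ cong (_+_ ε) (sym (*-zeroʳ (toℚ (+ length z)))) ⟩
       ε + toℚ (+ length z) * 0ℚ        ≤⟨ +-mono-≤ ε≤ 0≤ ⟩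
       value H n B + value H n (α z)    ≡⟨ sym (value-⊕ H n B (α z)) ⟩
       value H n (B ⊕ α z)              ≡⟨ cong (value H n) αz ⟩
       value H n O                      ≡⟨ value-O H n ⟩
       0ℚ                               ∎) }

form-O≃0ᴿ : ∀ H → HalfPlane.form H (ι O) ≃ᴿ 0ᴿ
form-O≃0ᴿ H ε 0<ε = 0 , λ n _ → subst (λ t → ∣ t - 0ℚ ∣ < ε) (sym (value-O H n)) 0<ε

SLC⇒LC : ∀ X → SLC X → LC X
SLC⇒LC X slc@(H , _) =
  let ε , 0<ε , uniform = SLC-uniform X slc
      H₀ = record { a = HalfPlane.a H ; b = HalfPlane.b H ; c = 0ᴿ
                  ; nondegenerate = HalfPlane.nondegenerate H }
  in H₀ , form-O≃0ᴿ H₀ , λ { (x , y) A∈X →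
       ε , 0<ε , eventually-map (λ n ε≤ → subst (_≤ value H n (x , y)) (sym (+-identityˡ ε)) ε≤) (uniform (x , y) A∈X) }

-- Integral half-planes: from an integral form back to SLC and CC

0≤toℚ : ∀ n → 0ℚ ≤ toℚ (+ n)
0≤toℚ n = toℚ-mono-≤ {0ℤ} {+ n} (ℤ.+≤+ z≤n)

suc-gap : ∀ {x y} → x ℤ.< y → toℚ x + 1ℚ ≤ toℚ y
suc-gap {x} {y} x<y = begin
  toℚ x + 1ℚ         ≡⟨ +-comm (toℚ x) 1ℚ ⟩
  1ℚ + toℚ x         ≡⟨ sym (toℚ-+ 1ℤ x) ⟩
  toℚ (1ℤ ℤ.+ x)     ≤⟨ toℚ-mono-≤ (ℤ.i<j⇒suc[i]≤j x<y) ⟩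
  toℚ y              ∎
  where open ≤-Reasoning

≢0⇒# : ∀ {z} → z ≢ 0ℤ → fromℤ z #ᴿ 0ᴿ
≢0⇒# {z} z≢0 with ℤ.<-cmp z 0ℤ
... | tri< z<0 _ _ = inj₁ (1ℚ , 0<1 , 0 , λ _ _ → suc-gap z<0)
... | tri≈ _ z≡0 _ = contradiction z≡0 z≢0
... | tri> _ _ 0<z = inj₂ (1ℚ , 0<1 , 0 , λ _ _ → suc-gap 0<z)

integral : (h : ℤ²) (c : ℝ) → (proj₁ h ≢ 0ℤ) ⊎ (proj₂ h ≢ 0ℤ) → HalfPlane
integral (p , q) c h≢0 = record
  { a = fromℤ p ; b = fromℤ q ; c = c ; nondegenerate = Sum.map ≢0⇒# ≢0⇒# h≢0 }

1≤integral : ∀ h {A c} {h≢0 : (proj₁ h ≢ 0ℤ) ⊎ (proj₂ h ≢ 0ℤ)} → 0ℤ ℤ.< h ∙ A →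
  ∀ n → 1ℚ ≤ value (integral h c h≢0) n A
1≤integral h@(p , q) {A} 0<h∙A n = subst (1ℚ ≤_) (sym (linear-toℚ p q A))
  (toℚ-mono-≤ {1ℤ} (ℤ.i<j⇒suc[i]≤j 0<h∙A))

inside₀ : ∀ h h≢0 A → 0ℤ ℤ.< h ∙ A → ι A ∈ Inside (integral h 0ᴿ h≢0)
inside₀ h h≢0 A@(_ , _) 0<h∙A = 1ℚ , 0<1 , 0 , λ n _ → 1≤integral h {A} {0ᴿ} {h≢0} 0<h∙A n

-- An integral form positive on the steps is at least 1 there and 0 at `O`, so the line at height
-- `½` leaves a margin of `½` on both sides.
positive⇒SLC : ∀ {X} h → (proj₁ h ≢ 0ℤ) ⊎ (proj₂ h ≢ 0ℤ) →
  (∀ A → A ∈ Step X → 0ℤ ℤ.< h ∙ A) → SLC X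
positive⇒SLC h h≢0 0<h =
  H , (½ , 0<½ , 0 , λ n _ → ≤-reflexive (trans (cong (_+ ½) (value-O H n)) (+-identityˡ ½)))
    , λ { A@(_ , _) A∈X → ½ , 0<½ , 0 , λ n _ → 1≤integral h {A} {constᴿ ½} {h≢0} (0<h A A∈X) n }
  where
  H = integral h (constᴿ ½) h≢0
  0<½ : 0ℚ < ½
  0<½ = positive⁻¹ ½

odd≢0 : ∀ k → + 2 ℤ.* k ℤ.+ 1ℤ ≢ 0ℤ
odd≢0 k eq = ℕ.even≢odd ℤ.∣ k ∣ 0 (trans (sym (ℤ.abs-* (+ 2) k)) (cong ℤ.∣_∣ 2k≡-1))
  where
  2k≡-1 : + 2 ℤ.* k ≡ -[1+ 0 ]
  2k≡-1 = trans (rearrange (+ 2 ℤ.* k)) (cong (ℤ._- 1ℤ) eq)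
    where
    rearrange : ∀ i → i ≡ i ℤ.+ 1ℤ ℤ.- 1ℤ
    rearrange = solve-∀

-- Doubling a coercive form leaves room to add either coordinate, and the two
-- resulting forms have odd, hence nonzero, determinant.
skewˣ skewʸ : ℤ² → ℤ²
skewˣ (p , q) = + 2 ℤ.* p ℤ.+ 1ℤ , + 2 ℤ.* q
skewʸ (p , q) = + 2 ℤ.* p , + 2 ℤ.* q ℤ.+ 1ℤ

-- Coercivity used twice gives `2 norm A`, and adding `x` costs at most `∣ x ∣`, which leaves
-- `norm A + ∣ y ∣`.
skewˣ>0 : ∀ h A → A ≢ O → Coercive h A → 0ℤ ℤ.< skewˣ h ∙ A
skewˣ>0 (p , q) A@(x , y) A≢O coercive = begin-strict
  0ℤ                                                  <⟨ ℤ.+<+ (norm>0 A≢O) ⟩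
  + norm A                                            ≤⟨ ℤ.i≤i+j (+ norm A) (+ ℤ.∣ y ∣) ⟩
  + norm A ℤ.+ + ℤ.∣ y ∣                              ≡⟨ double (+ ℤ.∣ x ∣) (+ ℤ.∣ y ∣) ⟩
  + norm A ℤ.+ + norm A ℤ.+ ℤ.- + ℤ.∣ x ∣             ≤⟨ ℤ.+-mono-≤ (ℤ.+-mono-≤ coercive coercive) (-∣i∣≤i x) ⟩
  (p , q) ∙ A ℤ.+ (p , q) ∙ A ℤ.+ x                   ≡⟨ expand p q x y ⟩
  skewˣ (p , q) ∙ A                                   ∎
  where
  open ℤ.≤-Reasoning
  double : ∀ i j → (i ℤ.+ j) ℤ.+ j ≡ (i ℤ.+ j) ℤ.+ (i ℤ.+ j) ℤ.+ ℤ.- i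
  double = solve-∀
  expand : ∀ p q x y → (p ℤ.* x ℤ.+ q ℤ.* y) ℤ.+ (p ℤ.* x ℤ.+ q ℤ.* y) ℤ.+ x
    ≡ (+ 2 ℤ.* p ℤ.+ 1ℤ) ℤ.* x ℤ.+ (+ 2 ℤ.* q) ℤ.* y
  expand = solve-∀

skewʸ>0 : ∀ h A → A ≢ O → Coercive h A → 0ℤ ℤ.< skewʸ h ∙ A
skewʸ>0 (p , q) A@(x , y) A≢O coercive = begin-strict
  0ℤ                                                  <⟨ ℤ.+<+ (norm>0 A≢O) ⟩
  + norm A                                            ≤⟨ ℤ.i≤i+j (+ norm A) (+ ℤ.∣ x ∣) ⟩
  + norm A ℤ.+ + ℤ.∣ x ∣                              ≡⟨ double (+ ℤ.∣ x ∣) (+ ℤ.∣ y ∣) ⟩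
  + norm A ℤ.+ + norm A ℤ.+ ℤ.- + ℤ.∣ y ∣             ≤⟨ ℤ.+-mono-≤ (ℤ.+-mono-≤ coercive coercive) (-∣i∣≤i y) ⟩
  (p , q) ∙ A ℤ.+ (p , q) ∙ A ℤ.+ y                   ≡⟨ expand p q x y ⟩
  skewʸ (p , q) ∙ A                                   ∎
  where
  open ℤ.≤-Reasoning
  double : ∀ i j → (i ℤ.+ j) ℤ.+ i ≡ (i ℤ.+ j) ℤ.+ (i ℤ.+ j) ℤ.+ ℤ.- j
  double = solve-∀
  expand : ∀ p q x y → (p ℤ.* x ℤ.+ q ℤ.* y) ℤ.+ (p ℤ.* x ℤ.+ q ℤ.* y) ℤ.+ y
    ≡ (+ 2 ℤ.* p) ℤ.* x ℤ.+ (+ 2 ℤ.* q ℤ.+ 1ℤ) ℤ.* y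
  expand = solve-∀

coercive⇒SLC : ∀ X → CoerciveOn X → SLC X
coercive⇒SLC X (h , coercive) = positive⇒SLC {X} (skewˣ h) (inj₁ (odd≢0 (proj₁ h)))
  λ A A∈X → skewˣ>0 h A (Step≢O X A∈X) (coercive A A∈X)

≢⇒# : ∀ a b c d → a ℤ.* b ≢ c ℤ.* d → (fromℤ a *ᴿ fromℤ b) #ᴿ (fromℤ c *ᴿ fromℤ d)
≢⇒# a b c d ab≢cd with ℤ.<-cmp (a ℤ.* b) (c ℤ.* d)
... | tri≈ _ ab≡cd _ = contradiction ab≡cd ab≢cd
... | tri< ab<cd _ _ = inj₁ (1ℚ , 0<1 , 0 , λ _ _ →
        subst₂ (λ s t → s + 1ℚ ≤ t) (toℚ-* a b) (toℚ-* c d) (suc-gap ab<cd))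
... | tri> _ _ cd<ab = inj₂ (1ℚ , 0<1 , 0 , λ _ _ →
        subst₂ (λ s t → s + 1ℚ ≤ t) (toℚ-* c d) (toℚ-* a b) (suc-gap cd<ab))

coercive⇒CC : ∀ X → CoerciveOn X → CC X
coercive⇒CC X (h@(p , q) , coercive) =
  record { H₁ = Hˣ ; H₂ = Hʸ ; nonParallel = ≢⇒# (+ 2 ℤ.* p ℤ.+ 1ℤ) (+ 2 ℤ.* q ℤ.+ 1ℤ) (+ 2 ℤ.* p) (+ 2 ℤ.* q) nonParallel }
  , (form-O≃0ᴿ Hˣ , form-O≃0ᴿ Hʸ)
  , λ A A∈X → let A≢O = Step≢O X A∈X ; cA = coercive A A∈X in
      inside₀ (skewˣ h) (inj₁ (odd≢0 p)) A (skewˣ>0 h A A≢O cA) , inside₀ (skewʸ h) (inj₂ (odd≢0 q)) A (skewʸ>0 h A A≢O cA)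
  where
  Hˣ = integral (skewˣ h) 0ᴿ (inj₁ (odd≢0 p))
  Hʸ = integral (skewʸ h) 0ᴿ (inj₂ (odd≢0 q))
  expand : ∀ p q → + 2 ℤ.* (p ℤ.+ q) ℤ.+ 1ℤ
    ≡ (+ 2 ℤ.* p ℤ.+ 1ℤ) ℤ.* (+ 2 ℤ.* q ℤ.+ 1ℤ) ℤ.- (+ 2 ℤ.* p) ℤ.* (+ 2 ℤ.* q)
  expand = solve-∀
  nonParallel : (+ 2 ℤ.* p ℤ.+ 1ℤ) ℤ.* (+ 2 ℤ.* q ℤ.+ 1ℤ) ≢ (+ 2 ℤ.* p) ℤ.* (+ 2 ℤ.* q)
  nonParallel eq = odd≢0 (p ℤ.+ q) (trans (expand p q) (ℤ.i≡j⇒i-j≡0 eq))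

-- From a real cone to an integral form

clear-denominators : ∀ a b → ∃ λ h → ∀ A → toℚ (+ norm A) ≤ linear a b A → Coercive h A
clear-denominators a b = (↥ a ℤ.* ↧ b , ↧ a ℤ.* ↥ b) , λ { A@(x , y) norm≤ → toℚ-cancel-≤ (begin
  toℚ (+ norm A)
    ≡⟨ sym (*-identityˡ (toℚ (+ norm A))) ⟩
  1ℚ * toℚ (+ norm A)
    -- Both denominators are at least 1, so multiplying by them only enlarges the norm side.
    ≤⟨ *-monoʳ (toℚ (+ norm A)) (0≤toℚ (norm A)) (toℚ-mono-≤ {1ℤ} {↧ a ℤ.* ↧ b} (ℤ.+≤+ (s≤s z≤n))) ⟩
  toℚ (↧ a ℤ.* ↧ b) * toℚ (+ norm A)
    ≤⟨ *-monoˡ (toℚ (↧ a ℤ.* ↧ b)) (toℚ-mono-≤ {0ℤ} {↧ a ℤ.* ↧ b} (ℤ.+≤+ z≤n)) norm≤ ⟩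
  toℚ (↧ a ℤ.* ↧ b) * linear a b A
    ≡⟨ cong (_* linear a b A) (toℚ-* (↧ a) (↧ b)) ⟩
  toℚ (↧ a) * toℚ (↧ b) * linear a b A
    ≡⟨ expand (toℚ (↧ a)) (toℚ (↧ b)) a b (toℚ x) (toℚ y) ⟩
  linear (toℚ (↧ a) * a * toℚ (↧ b)) (toℚ (↧ a) * (toℚ (↧ b) * b)) A
    ≡⟨ cong₂ (λ s t → linear (s * toℚ (↧ b)) (toℚ (↧ a) * t) A) (toℚ-↥ a) (toℚ-↥ b) ⟩
  linear (toℚ (↥ a) * toℚ (↧ b)) (toℚ (↧ a) * toℚ (↥ b)) A
    ≡⟨ sym (cong₂ (λ s t → linear s t A) (toℚ-* (↥ a) (↧ b)) (toℚ-* (↧ a) (↥ b))) ⟩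
  linear (toℚ (↥ a ℤ.* ↧ b)) (toℚ (↧ a ℤ.* ↥ b)) A
    ≡⟨ linear-toℚ (↥ a ℤ.* ↧ b) (↧ a ℤ.* ↥ b) A ⟩
  toℚ ((↥ a ℤ.* ↧ b , ↧ a ℤ.* ↥ b) ∙ A) ∎) }
  where
  open ≤-Reasoning
  expand : ∀ d e a b x y → d * e * (a * x + b * y) ≡ d * a * e * x + d * (e * b) * y
  expand = solve 6 (λ d e a b x y → d :* e :* (a :* x :+ b :* y)
    := d :* a :* e :* x :+ d :* (e :* b) :* y) refl
    where open +-*-Solver

toℚ-norm : ∀ x y → toℚ (+ norm (x , y)) ≡ ∣ toℚ x ∣ + ∣ toℚ y ∣
toℚ-norm x y = trans (toℚ-+ (+ ℤ.∣ x ∣) (+ ℤ.∣ y ∣)) (cong₂ _+_ (toℚ-∣∣ x) (toℚ-∣∣ y))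

product-≤ : ∀ p r {B} → ∣ p ∣ ≤ B → p * r ≤ B * ∣ r ∣
product-≤ p r {B} p≤B = begin
  p * r              ≤⟨ p≤∣p∣ (p * r) ⟩
  ∣ p * r ∣          ≡⟨ ∣p*q∣≡∣p∣*∣q∣ p r ⟩
  ∣ p ∣ * ∣ r ∣      ≤⟨ *-monoʳ ∣ r ∣ (0≤∣p∣ r) p≤B ⟩
  B * ∣ r ∣          ∎
  where open ≤-Reasoning

linear-close : ∀ a b c d {η} A → ∣ a - c ∣ ≤ η → ∣ b - d ∣ ≤ η →
  linear a b A ≤ linear c d A + η * toℚ (+ norm A)
linear-close a b c d {η} (x , y) a≈c b≈d = begin
  a * X + b * Y
    ≡⟨ regroup a b c d X Y ⟩
  (c * X + d * Y) + ((a - c) * X + (b - d) * Y)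
    ≤⟨ +-monoʳ-≤ (c * X + d * Y) (+-mono-≤ (product-≤ (a - c) X a≈c) (product-≤ (b - d) Y b≈d)) ⟩
  (c * X + d * Y) + (η * ∣ X ∣ + η * ∣ Y ∣)
    ≡⟨ cong (_+_ (c * X + d * Y)) (sym (*-distribˡ-+ η ∣ X ∣ ∣ Y ∣)) ⟩
  (c * X + d * Y) + η * (∣ X ∣ + ∣ Y ∣)
    ≡⟨ cong (λ t → (c * X + d * Y) + η * t) (sym (toℚ-norm x y)) ⟩
  (c * X + d * Y) + η * toℚ (+ norm (x , y)) ∎
  where
  open ≤-Reasoning
  X = toℚ x
  Y = toℚ y
  regroup : ∀ a b c d x y → a * x + b * y ≡ (c * x + d * y) + ((a - c) * x + (b - d) * y)
  regroup = solve 6 (λ a b c d x y → a :* x :+ b :* y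
    := (c :* x :+ d :* y) :+ ((a :- c) :* x :+ (b :- d) :* y)) refl
    where open +-*-Solver

-- Cramer's rule read as an estimate: `z` is a coordinate, `D` the determinant and `f`, `g` the
-- values of the two forms, whose nonnegativity turns `∣ f ∣ + ∣ g ∣` into `f + g`.
cramer-≤ : ∀ {δ D B} z u v f g → 0ℚ ≤ δ → δ ≤ D → D * z ≡ u * f - v * g →
  ∣ u ∣ ≤ B → ∣ v ∣ ≤ B → 0ℚ ≤ f → 0ℚ ≤ g → δ * ∣ z ∣ ≤ B * (f + g)
cramer-≤ {δ} {D} {B} z u v f g 0≤δ δ≤D cramer u≤B v≤B 0≤f 0≤g = begin
  δ * ∣ z ∣                       ≤⟨ *-monoʳ ∣ z ∣ (0≤∣p∣ z) δ≤D ⟩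
  D * ∣ z ∣                       ≡⟨ cong (_* ∣ z ∣) (sym (0≤p⇒∣p∣≡p (≤-trans 0≤δ δ≤D))) ⟩
  ∣ D ∣ * ∣ z ∣                   ≡⟨ sym (∣p*q∣≡∣p∣*∣q∣ D z) ⟩
  ∣ D * z ∣                       ≡⟨ cong ∣_∣ cramer ⟩
  ∣ u * f - v * g ∣               ≤⟨ ∣p-q∣≤∣p∣+∣q∣ (u * f) (v * g) ⟩
  ∣ u * f ∣ + ∣ v * g ∣           ≤⟨ +-mono-≤ (bound u f u≤B 0≤f) (bound v g v≤B 0≤g) ⟩
  B * f + B * g                   ≡⟨ sym (*-distribˡ-+ B f g) ⟩
  B * (f + g)                     ∎
  where
  open ≤-Reasoning
  bound : ∀ u f → ∣ u ∣ ≤ B → 0ℚ ≤ f → ∣ u * f ∣ ≤ B * f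
  bound u f u≤B 0≤f = begin
    ∣ u * f ∣          ≡⟨ ∣p*q∣≡∣p∣*∣q∣ u f ⟩
    ∣ u ∣ * ∣ f ∣      ≡⟨ cong (∣ u ∣ *_) (0≤p⇒∣p∣≡p 0≤f) ⟩
    ∣ u ∣ * f          ≤⟨ *-monoʳ f 0≤f u≤B ⟩
    B * f              ∎

-- Inverting the pair of forms bounds a point by their values at it.
norm-≤-forms : ∀ {δ B} a b c d A → 0ℚ ≤ δ → c * b + δ ≤ a * d →
  ∣ a ∣ ≤ B → ∣ b ∣ ≤ B → ∣ c ∣ ≤ B → ∣ d ∣ ≤ B →
  0ℚ ≤ linear a b A → 0ℚ ≤ linear c d A →
  δ * toℚ (+ norm A) ≤ (B + B) * (linear a b A + linear c d A)
norm-≤-forms {δ} {B} a b c d A@(x , y) 0≤δ gap a≤B b≤B c≤B d≤B 0≤f 0≤g = begin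
  δ * toℚ (+ norm A)              ≡⟨ cong (δ *_) (toℚ-norm x y) ⟩
  δ * (∣ X ∣ + ∣ Y ∣)             ≡⟨ *-distribˡ-+ δ ∣ X ∣ ∣ Y ∣ ⟩
  δ * ∣ X ∣ + δ * ∣ Y ∣           ≤⟨ +-mono-≤
      (cramer-≤ X d b f g 0≤δ δ≤D (cramer-x a b c d X Y) d≤B b≤B 0≤f 0≤g)
      (cramer-≤ Y a c g f 0≤δ δ≤D (cramer-y a b c d X Y) a≤B c≤B 0≤g 0≤f) ⟩
  B * (f + g) + B * (g + f)       ≡⟨ collect B f g ⟩
  (B + B) * (f + g)               ∎
  where
  open ≤-Reasoning
  X = toℚ x
  Y = toℚ y
  f = linear a b A
  g = linear c d A
  cramer-x : ∀ a b c d x y → (a * d - c * b) * x ≡ d * (a * x + b * y) - b * (c * x + d * y)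
  cramer-x = solve 6 (λ a b c d x y → (a :* d :- c :* b) :* x
    := d :* (a :* x :+ b :* y) :- b :* (c :* x :+ d :* y)) refl
    where open +-*-Solver
  cramer-y : ∀ a b c d x y → (a * d - c * b) * y ≡ a * (c * x + d * y) - c * (a * x + b * y)
  cramer-y = solve 6 (λ a b c d x y → (a :* d :- c :* b) :* y
    := a :* (c :* x :+ d :* y) :- c :* (a :* x :+ b :* y)) refl
    where open +-*-Solver
  collect : ∀ B f g → B * (f + g) + B * (g + f) ≡ (B + B) * (f + g)
  collect = solve 3 (λ B f g → B :* (f :+ g) :+ B :* (g :+ f) := (B :+ B) :* (f :+ g)) refl
    where open +-*-Solver
  cancel : ∀ p δ → p + δ - p ≡ δ
  cancel = solve 2 (λ p δ → p :+ δ :- p := δ) refl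
    where open +-*-Solver
  δ≤D : δ ≤ a * d - c * b
  δ≤D = subst (_≤ a * d - c * b) (cancel (c * b) δ) (+-monoˡ-≤ (- (c * b)) gap)

eventually-bounded-all : ∀ xs →
  Σ[ B ∈ ℚ ] (0ℚ < B × Eventually (λ n → All (λ x → ∣ seq x n ∣ ≤ B) xs))
eventually-bounded-all []       = 1ℚ , 0<1 , 0 , λ _ _ → []
eventually-bounded-all (x ∷ xs) =
  let B , 0<B , x≤B  = eventually-bounded x
      C , 0<C , xs≤C = eventually-bounded-all xs
      B≤ : B ≤ B + C
      B≤ = subst (_≤ B + C) (+-identityʳ B) (+-monoʳ-≤ B (<⇒≤ 0<C))
      C≤ : C ≤ B + C
      C≤ = subst (_≤ B + C) (+-identityˡ C) (+-monoˡ-≤ C (<⇒≤ 0<B))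
  in B + C , +-mono-< 0<B 0<C , eventually-map₂
       (λ _ x≤ xs≤ → ≤-trans x≤ B≤ ∷ All.map (λ y≤ → ≤-trans y≤ C≤) xs≤) x≤B xs≤C

linear-+ : ∀ a b c d A → linear a b A + linear c d A ≡ linear (a + c) (b + d) A
linear-+ a b c d (x , y) = lemma a b c d (toℚ x) (toℚ y)
  where
  lemma : ∀ a b c d x y → (a * x + b * y) + (c * x + d * y) ≡ (a + c) * x + (b + d) * y
  lemma = solve 6 (λ a b c d x y → (a :* x :+ b :* y) :+ (c :* x :+ d :* y)
    := (a :+ c) :* x :+ (b :+ d) :* y) refl
    where open +-*-Solver

linear-scale : ∀ k a b A → k * linear a b A ≡ linear (k * a) (k * b) A
linear-scale k a b (x , y) = lemma k a b (toℚ x) (toℚ y)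
  where
  lemma : ∀ k a b x y → k * (a * x + b * y) ≡ k * a * x + k * b * y
  lemma = solve 5 (λ k a b x y → k :* (a :* x :+ b :* y) := k :* a :* x :+ k :* b :* y) refl
    where open +-*-Solver

-- By the choice of `η` the error `C * η * D` is half of `δ * D`, so it moves to the left and leaves
-- `δ * ½ * D ≤ C * G′`; multiplying by `σ`, the inverse of `δ * ½`, isolates `D`.
absorb : ∀ {δ C η D G G′ σ} → 0ℚ ≤ C → 0ℚ ≤ σ → C * η ≡ δ * ½ → δ * ½ * σ ≡ 1ℚ →
  δ * D ≤ C * G → G ≤ G′ + η * D → D ≤ σ * C * G′
absorb {δ} {C} {η} {D} {G} {G′} {σ} 0≤C 0≤σ Cη≡δ½ δ½σ≡1 δD≤CG G≤ = begin
  D                               ≡⟨ sym (*-identityˡ D) ⟩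
  1ℚ * D                          ≡⟨ cong (_* D) (sym δ½σ≡1) ⟩
  h * σ * D                       ≡⟨ expand h σ D ⟩
  σ * ((h + h) * D - h * D)       ≡⟨ cong (λ t → σ * (t * D - h * D)) (halves δ) ⟩
  σ * (δ * D - h * D)             ≤⟨ *-monoˡ σ 0≤σ (+-monoˡ-≤ (- (h * D)) (≤-trans δD≤CG (*-monoˡ C 0≤C G≤))) ⟩
  σ * (C * (G′ + η * D) - h * D)  ≡⟨ collect C σ η D G′ h ⟩
  σ * C * G′ + σ * (C * η - h) * D ≡⟨ cong (λ t → σ * C * G′ + σ * (t - h) * D) Cη≡δ½ ⟩
  σ * C * G′ + σ * (h - h) * D    ≡⟨ vanish (σ * C * G′) σ h D ⟩
  σ * C * G′                      ∎
  where
  open ≤-Reasoning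
  h = δ * ½
  expand : ∀ h σ D → h * σ * D ≡ σ * ((h + h) * D - h * D)
  expand = solve 3 (λ h σ D → h :* σ :* D := σ :* ((h :+ h) :* D :- h :* D)) refl
    where open +-*-Solver
  collect : ∀ C σ η D G h → σ * (C * (G + η * D) - h * D) ≡ σ * C * G + σ * (C * η - h) * D
  collect = solve 6 (λ C σ η D G h → σ :* (C :* (G :+ η :* D) :- h :* D)
    := σ :* C :* G :+ σ :* (C :* η :- h) :* D) refl
    where open +-*-Solver
  vanish : ∀ t σ h D → t + σ * (h - h) * D ≡ t
  vanish = solve 4 (λ t σ h D → t :+ σ :* (h :- h) :* D := t) refl
    where open +-*-Solver

-- The sum of the two forms dominates a multiple of the norm of a step only from an index depending
-- on that step. Moving from there to the fixed index `m` costs at most `η` times the norm, which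
-- `absorb` recovers, so the rational coefficients at `m` serve for all steps.
oriented⇒coercive : ∀ X H K → ι O ∈ Boundary H → ι O ∈ Boundary K →
  HalfPlane.a K *ᴿ HalfPlane.b H <ᴿ HalfPlane.a H *ᴿ HalfPlane.b K →
  (∀ A → A ∈ Step X → ι A ∈ Inside H × ι A ∈ Inside K) → CoerciveOn X
oriented⇒coercive X H K O∈H O∈K (δ , 0<δ , gap) inside =
  let h , coercive = clear-denominators (σ * C * seq s m) (σ * C * seq t m)
  in h , λ A A∈X → coercive A (dominates A A∈X)
  where
  open HalfPlane H using (a; b)
  open HalfPlane K renaming (a to c; b to d) using ()
  bounds = eventually-bounded-all (a ∷ b ∷ c ∷ d ∷ [])
  B = proj₁ bounds
  0<B = proj₁ (proj₂ bounds)
  bounded = proj₂ (proj₂ bounds)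
  C = B + B
  0<C : 0ℚ < C
  0<C = +-mono-< 0<B 0<B
  η-data = quotient {δ * ½} {C} (half-pos 0<δ) 0<C
  η = proj₁ η-data
  0<η = proj₁ (proj₂ η-data)
  σ-data = quotient {1ℚ} {δ * ½} 0<1 (half-pos 0<δ)
  σ = proj₁ σ-data
  0<σ = proj₁ (proj₂ σ-data)
  s = a +ᴿ c
  t = b +ᴿ d
  M = proj₁ (cauchy s η 0<η)
  N = proj₁ (cauchy t η 0<η)
  m = M ℕ.⊔ N
  dominates : ∀ A → A ∈ Step X → toℚ (+ norm A) ≤ linear (σ * C * seq s m) (σ * C * seq t m) A
  dominates A A∈X =
    let ε₁ , 0<ε₁ , f≥ = boundary-inside H A O∈H (proj₁ (inside A A∈X))
        ε₂ , 0<ε₂ , g≥ = boundary-inside K A O∈K (proj₂ (inside A A∈X))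
        -- The last eventual condition pushes `n` past `m`, where the Cauchy estimates compare the
        -- two indices.
        n , ((0≤f , 0≤g) , (cb+δ≤ad , bs)) , m≤n = eventually⇒∃ (eventually-map₂ (λ _ → _,_)
          (eventually-map₂ (λ _ → _,_)
            (eventually-map₂ (λ _ ε₁≤ ε₂≤ → ≤-trans (<⇒≤ 0<ε₁) ε₁≤ , ≤-trans (<⇒≤ 0<ε₂) ε₂≤) f≥ g≥)
            (eventually-map₂ (λ _ → _,_) gap bounded))
          (m , λ _ m≤n → m≤n))
    in conclude A n 0≤f 0≤g cb+δ≤ad bs m≤n
    where
    conclude : ∀ A n → 0ℚ ≤ value H n A → 0ℚ ≤ value K n A →
      seq c n * seq b n + δ ≤ seq a n * seq d n →
      All (λ x → ∣ seq x n ∣ ≤ B) (a ∷ b ∷ c ∷ d ∷ []) → m ℕ.≤ n →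
      toℚ (+ norm A) ≤ linear (σ * C * seq s m) (σ * C * seq t m) A
    conclude A n 0≤f 0≤g cb+δ≤ad (a≤B ∷ b≤B ∷ c≤B ∷ d≤B ∷ []) m≤n =
      subst (toℚ (+ norm A) ≤_) (linear-scale (σ * C) (seq s m) (seq t m) A)
        (absorb {δ} {C} {η} (<⇒≤ 0<C) (<⇒≤ 0<σ) (proj₂ (proj₂ η-data)) (proj₂ (proj₂ σ-data))
          (norm-≤-forms (seq a n) (seq b n) (seq c n) (seq d n) A
            (<⇒≤ 0<δ) cb+δ≤ad a≤B b≤B c≤B d≤B 0≤f 0≤g)
          (≤-trans (≤-reflexive (linear-+ (seq a n) (seq b n) (seq c n) (seq d n) A))
            (linear-close (seq s n) (seq t n) (seq s m) (seq t m) A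
              (<⇒≤ (proj₂ (cauchy s η 0<η) n m (ℕ.m⊔n≤o⇒m≤o M N m≤n) (ℕ.m≤m⊔n M N)))
              (<⇒≤ (proj₂ (cauchy t η 0<η) n m (ℕ.m⊔n≤o⇒n≤o M N m≤n) (ℕ.m≤n⊔m M N))))))

CC⇒coercive : ∀ X → CC X → CoerciveOn X
CC⇒coercive X (record { H₁ = H ; H₂ = K ; nonParallel = inj₂ gap } , (O∈H , O∈K) , inside) =
  oriented⇒coercive X H K O∈H O∈K gap inside
CC⇒coercive X (record { H₁ = H ; H₂ = K ; nonParallel = inj₁ gap } , (O∈H , O∈K) , inside) =
  oriented⇒coercive X K H O∈K O∈H gap λ A A∈X → proj₂ (inside A A∈X) , proj₁ (inside A A∈X)

-- Counterexamples

horizontal : StepSet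
horizontal = record { Step = λ (x , y) → y ≡ 1ℤ ; O∉Step = λ () }

horizontal-SLC : SLC horizontal
horizontal-SLC = positive⇒SLC {horizontal} (0ℤ , 1ℤ) (inj₂ λ ()) λ { (x , _) refl → ℤ.+<+ (s≤s z≤n) }

-- The paths `(n , 1) , (- n , 1)` to `(0 , 2)` all have length 2, so their infinitude is measured
-- by `weight`.
horizontal-¬FPP : ¬ FPP horizontal
horizontal-¬FPP fpp = unbounded⇒Infinite weight
  (λ n → (+ n , 1ℤ) ∷ (ℤ.- + n , 1ℤ) ∷ []
       , ((refl ∷ refl ∷ []) , cong (_, + 2) (cancel (+ n)))
       , ℕ.≤-trans (ℕ.m≤m+n n 1) (ℕ.m≤m+n (n ℕ.+ 1) _))
  (fpp (0ℤ , + 2) (add {A = 0ℤ , 1ℤ} {B = 0ℤ , 1ℤ} (gen refl) (gen refl)))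
  where
  cancel : ∀ i → i ℤ.+ (ℤ.- i ℤ.+ 0ℤ) ≡ 0ℤ
  cancel = solve-∀

-- The parabola with one step to the left: FPP without LC

parabola : StepSet
parabola = record
  { Step   = λ v → v ≡ (-[1+ 0 ] , 0ℤ) ⊎ ∃ λ n → v ≡ (+ (suc n ℕ.* suc n) , + suc n)
  ; O∉Step = λ { (inj₁ ()) ; (inj₂ (_ , ())) } }

-- Nonnegative heights cannot cancel. For the parabola this bounds the height of every step of a
-- path by that of the endpoint.
entry≤sum : ∀ w → All (λ v → 0ℤ ℤ.≤ proj₂ v) w →
  0ℤ ℤ.≤ proj₂ (α w) × All (λ v → proj₂ v ℤ.≤ proj₂ (α w)) w
entry≤sum []            []          = ℤ.≤-refl , []
entry≤sum ((x , y) ∷ w) (0≤y ∷ 0≤w) =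
  let 0≤Y , w≤Y = entry≤sum w 0≤w
      Y≤y+Y = subst (ℤ._≤ y ℤ.+ proj₂ (α w)) (ℤ.+-identityˡ _) (ℤ.+-monoˡ-≤ (proj₂ (α w)) 0≤y)
  in ℤ.+-mono-≤ 0≤y 0≤Y
   , subst (ℤ._≤ y ℤ.+ proj₂ (α w)) (ℤ.+-identityʳ y) (ℤ.+-monoʳ-≤ y 0≤Y)
   ∷ All.map (λ v≤ → ℤ.≤-trans v≤ Y≤y+Y) w≤Y

parabola-height≥0 : ∀ {v} → v ∈ Step parabola → 0ℤ ℤ.≤ proj₂ v
parabola-height≥0 (inj₁ refl)       = ℤ.≤-refl
parabola-height≥0 (inj₂ (n , refl)) = ℤ.+≤+ z≤n

-- A step (x , y) of height y ≤ Y satisfies x ≤ Y y, so - x + (2 Y + 1) y ≥ ∣ x ∣ + ∣ y ∣.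
parabola-coercive : ∀ Y {v} → v ∈ Step parabola → proj₂ v ℤ.≤ Y →
  Coercive (-[1+ 0 ] , Y ℤ.+ Y ℤ.+ 1ℤ) v
parabola-coercive Y (inj₁ refl) _ = ℤ.≤-reflexive (sym (compute Y))
  where
  compute : ∀ Y → 1ℤ ℤ.+ (Y ℤ.+ Y ℤ.+ 1ℤ) ℤ.* 0ℤ ≡ 1ℤ
  compute = solve-∀
parabola-coercive Y (inj₂ (n , refl)) N≤Y = begin
  N ℤ.* N ℤ.+ N                                    ≡⟨ sym (ℤ.+-identityʳ _) ⟩
  N ℤ.* N ℤ.+ N ℤ.+ 0ℤ                             ≤⟨ ℤ.+-monoʳ-≤ (N ℤ.* N ℤ.+ N) 0≤ ⟩
  N ℤ.* N ℤ.+ N ℤ.+ (N ℤ.+ N) ℤ.* (Y ℤ.- N)        ≡⟨ expand N Y ⟩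
  -[1+ 0 ] ℤ.* (N ℤ.* N) ℤ.+ (Y ℤ.+ Y ℤ.+ 1ℤ) ℤ.* N ∎
  where
  open ℤ.≤-Reasoning
  N = + suc n
  0≤ : 0ℤ ℤ.≤ (N ℤ.+ N) ℤ.* (Y ℤ.- N)
  0≤ = subst (ℤ._≤ (N ℤ.+ N) ℤ.* (Y ℤ.- N)) (ℤ.*-zeroʳ (N ℤ.+ N))
         (ℤ.*-monoˡ-≤-nonNeg (N ℤ.+ N) (ℤ.i≤j⇒0≤j-i N≤Y))
  expand : ∀ N Y → N ℤ.* N ℤ.+ N ℤ.+ (N ℤ.+ N) ℤ.* (Y ℤ.- N)
    ≡ -[1+ 0 ] ℤ.* (N ℤ.* N) ℤ.+ (Y ℤ.+ Y ℤ.+ 1ℤ) ℤ.* N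
  expand = solve-∀

-- The height `Y` of the endpoint bounds all steps of the path, so each endpoint gets its own
-- coercive form although no single form serves the whole set.
parabola-FPP : FPP parabola
parabola-FPP A@(X , Y) _ =
  let ws , ⊆ws = coercive⇒Subfinite (-[1+ 0 ] , Y ℤ.+ Y ℤ.+ 1ℤ) A
  in ws , λ { {w} (w∈ , αw) → ⊆ws
       ( All.zipWith (λ {v} (v∈ , v≤) → Step≢O parabola v∈ , parabola-coercive Y v∈ v≤)
           (w∈ , subst (λ B → All (λ v → proj₂ v ℤ.≤ proj₂ B) w) αw
                   (proj₂ (entry≤sum w (All.map parabola-height≥0 w∈))))
       , αw) }

steep-≤0 : ∀ a b {q ε} → 0ℚ ≤ q → ε ≤ - a → b ≤ q * ε → a * (q * q) + b * q ≤ 0ℚ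
steep-≤0 a b {q} {ε} 0≤q ε≤-a b≤qε = begin
  a * (q * q) + b * q                    ≡⟨ regroup a b q ⟩
  q * (b - - a * q)                      ≤⟨ *-monoˡ q 0≤q (+-mono-≤ b≤qε (neg-antimono-≤ (*-monoʳ q 0≤q ε≤-a))) ⟩
  q * (q * ε - ε * q)                    ≡⟨ vanish q ε ⟩
  0ℚ                                     ∎
  where
  open ≤-Reasoning
  regroup : ∀ a b q → a * (q * q) + b * q ≡ q * (b - - a * q)
  regroup = solve 3 (λ a b q → a :* (q :* q) :+ b :* q := q :* (b :- :- a :* q)) refl
    where open +-*-Solver
  vanish : ∀ q ε → q * (q * ε - ε * q) ≡ 0ℚ
  vanish = solve 2 (λ q ε → q :* (q :* ε :- ε :* q) := con 0ℚ) refl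
    where open +-*-Solver

linear-left : ∀ a b → linear a b (-[1+ 0 ] , 0ℤ) ≡ - a
linear-left = solve 2 (λ a b → a :* con (- 1ℚ) :+ b :* con 0ℚ := :- a) refl
  where open +-*-Solver

linear-square : ∀ a b n → linear a b (+ (n ℕ.* n) , + n) ≡ a * (toℚ (+ n) * toℚ (+ n)) + b * toℚ (+ n)
linear-square a b n = cong (λ t → a * t + b * toℚ (+ n))
  (trans (cong toℚ (ℤ.pos-* n n)) (toℚ-* (+ n) (+ n)))

parabola-BPP : BPP parabola
parabola-BPP = FPP⇒BPP parabola parabola-FPP

-- The step `(-1 , 0)` forces `a ≤ - ε`, so at height `q` on the parabola the term `a * q * q`
-- outweighs `b * q` as soon as `q * ε` reaches a bound for `b`.
parabola-¬LC : ¬ LC parabola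
parabola-¬LC (H , O∈ , inside) =
  let ε , 0<ε , ε≤left  = boundary-inside H (-[1+ 0 ] , 0ℤ) O∈ (inside (-[1+ 0 ] , 0ℤ) (inj₁ refl))
      B , 0<B , ∣b∣≤B   = eventually-bounded (HalfPlane.b H)
      M , B≤Mε          = archimedean {B} {ε} 0<B 0<ε
      -- Heights on the parabola start at 1, so the step taken is the one at height `suc M`, and the
      -- bound by `M * ε` is enlarged to match.
      A                 = + (suc M ℕ.* suc M) , + suc M
      δ , 0<δ , δ≤right = boundary-inside H A O∈ (inside A (inj₂ (M , refl)))
      n , (ε≤ , ∣b∣≤) , δ≤ = eventually⇒∃ (eventually-map₂ (λ _ → _,_)
        (eventually-map₂ (λ _ → _,_) ε≤left ∣b∣≤B) δ≤right)
      a = seq (HalfPlane.a H) n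
      b = seq (HalfPlane.b H) n
      b≤ = ≤-trans (p≤∣p∣ b) (≤-trans ∣b∣≤ (≤-trans B≤Mε
             (*-monoʳ ε (<⇒≤ 0<ε) (toℚ-mono-≤ {+ M} {+ suc M} (ℤ.+≤+ (ℕ.n≤1+n M))))))
      value≤0 = subst (_≤ 0ℚ) (sym (linear-square a b (suc M)))
        (steep-≤0 a b {toℚ (+ suc M)} {ε} (0≤toℚ (suc M)) (subst (ε ≤_) (linear-left a b) ε≤) b≤)
  in <-irrefl refl (<-≤-trans 0<δ (≤-trans δ≤ value≤0))

-- The irrational slope e - 2 = Σ 1/(n+2)!, whose partial sums num n / den n have
-- denominator den n = (n+1)!; the next term divided by term n is ratio n = 1/(n+2).

reciprocal : ∀ n → Σ[ ratio ∈ ℚ ] (0ℚ < ratio × toℚ (+ suc (suc n)) * ratio ≡ 1ℚ)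
reciprocal n = quotient {1ℚ} {toℚ (+ suc (suc n))} 0<1 (toℚ-mono-< {0ℤ} {+ suc (suc n)} (ℤ.+<+ (s≤s z≤n)))

ratio : ℕ → ℚ
ratio n = proj₁ (reciprocal n)

0<ratio : ∀ n → 0ℚ < ratio n
0<ratio n = proj₁ (proj₂ (reciprocal n))

ratio-inverse : ∀ n → toℚ (+ suc (suc n)) * ratio n ≡ 1ℚ
ratio-inverse n = proj₂ (proj₂ (reciprocal n))

term : ℕ → ℚ
term zero    = 1ℚ
term (suc n) = term n * ratio n

0<term : ∀ n → 0ℚ < term n
0<term zero    = 0<1
0<term (suc n) = 0<* (0<term n) (0<ratio n)

partial : ℕ → ℚ
partial zero    = 0ℚ
partial (suc n) = partial n + term (suc n)

den num : ℕ → ℕ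
den zero    = 1
den (suc n) = suc (suc n) ℕ.* den n
num zero    = 0
num (suc n) = suc (suc n) ℕ.* num n ℕ.+ 1

den*term : ∀ n → toℚ (+ den n) * term n ≡ 1ℚ
den*term zero    = refl
den*term (suc n) = begin
  toℚ (+ den (suc n)) * (term n * ratio n)    ≡⟨ cong (_* (term n * ratio n)) (trans (cong toℚ (ℤ.pos-* (suc (suc n)) (den n))) (toℚ-* (+ suc (suc n)) (+ den n))) ⟩
  k * toℚ (+ den n) * (term n * ratio n)      ≡⟨ regroup k (toℚ (+ den n)) (term n) (ratio n) ⟩
  (k * ratio n) * (toℚ (+ den n) * term n)    ≡⟨ cong₂ _*_ (ratio-inverse n) (den*term n) ⟩
  1ℚ * 1ℚ                            ≡⟨ *-identityˡ 1ℚ ⟩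
  1ℚ                                 ∎
  where
  open ≡-Reasoning
  k : ℚ
  k = toℚ (+ suc (suc n))
  regroup : ∀ k den term ratio → k * den * (term * ratio) ≡ (k * ratio) * (den * term)
  regroup = solve 4 (λ k den term ratio → k :* den :* (term :* ratio) := (k :* ratio) :* (den :* term)) refl
    where open +-*-Solver

num≡den*partial : ∀ n → toℚ (+ num n) ≡ toℚ (+ den n) * partial n
num≡den*partial zero    = refl
num≡den*partial (suc n) = begin
  toℚ (+ (suc (suc n) ℕ.* num n ℕ.+ 1))    ≡⟨ toℚ-+ (+ (suc (suc n) ℕ.* num n)) 1ℤ ⟩
  toℚ (+ (suc (suc n) ℕ.* num n)) + 1ℚ     ≡⟨ cong₂ _+_ (homo (num n)) (sym (den*term (suc n))) ⟩
  k * toℚ (+ num n) + q′ * term (suc n)       ≡⟨ cong (λ t → k * t + q′ * term (suc n)) (num≡den*partial n) ⟩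
  k * (toℚ (+ den n) * partial n) + q′ * term (suc n) ≡⟨ cong (_+ q′ * term (suc n)) (sym (*-assoc k (toℚ (+ den n)) (partial n))) ⟩
  k * toℚ (+ den n) * partial n + q′ * term (suc n) ≡⟨ cong (λ t → t * partial n + q′ * term (suc n)) (sym (homo (den n))) ⟩
  q′ * partial n + q′ * term (suc n)              ≡⟨ sym (*-distribˡ-+ q′ (partial n) (term (suc n))) ⟩
  q′ * (partial n + term (suc n))                 ∎
  where
  open ≡-Reasoning
  k q′ : ℚ
  k = toℚ (+ suc (suc n))
  q′ = toℚ (+ den (suc n))
  homo : ∀ m → toℚ (+ (suc (suc n) ℕ.* m)) ≡ k * toℚ (+ m)
  homo m = trans (cong toℚ (ℤ.pos-* (suc (suc n)) m)) (toℚ-* (+ suc (suc n)) (+ m))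

den>n : ∀ n → n ℕ.< den n
den>n zero    = s≤s z≤n
den>n (suc n) = ℕ.≤-trans (s≤s (den>n n)) (ℕ.+-mono-≤ {1} {den n} (ℕ.≤-trans (s≤s z≤n) (den>n n)) (ℕ.m≤m+n (den n) _))

-- Each term is at most half the previous one, so all later terms together stay within twice the
-- next one: `partial n` and `upper n` enclose the limit.
upper : ℕ → ℚ
upper n = partial n + (term (suc n) + term (suc n))

ratio+ratio≤1 : ∀ n → ratio n + ratio n ≤ 1ℚ
ratio+ratio≤1 n = begin
  ratio n + ratio n                     ≡⟨ sym (double (ratio n)) ⟩
  toℚ (+ 2) * ratio n               ≤⟨ *-monoʳ (ratio n) (<⇒≤ (0<ratio n)) (toℚ-mono-≤ {+ 2} {+ suc (suc n)} (ℤ.+≤+ (s≤s (s≤s z≤n)))) ⟩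
  toℚ (+ suc (suc n)) * ratio n     ≡⟨ ratio-inverse n ⟩
  1ℚ                            ∎
  where
  open ≤-Reasoning
  double : ∀ ratio → (1ℚ + 1ℚ) * ratio ≡ ratio + ratio
  double ratio = trans (*-distribʳ-+ ratio 1ℚ 1ℚ) (cong₂ _+_ (*-identityˡ ratio) (*-identityˡ ratio))

partial-step : ∀ n → partial n ≤ partial (suc n)
partial-step n = subst (_≤ partial n + term (suc n)) (+-identityʳ (partial n)) (+-monoʳ-≤ (partial n) (<⇒≤ (0<term (suc n))))

upper-step : ∀ n → upper (suc n) ≤ upper n
upper-step n = begin
  partial n + ρ + (ρ * ratio (suc n) + ρ * ratio (suc n))   ≡⟨ cong (_+_ (partial n + ρ)) (sym (*-distribˡ-+ ρ (ratio (suc n)) (ratio (suc n)))) ⟩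
  partial n + ρ + ρ * (ratio (suc n) + ratio (suc n))       ≤⟨ +-monoʳ-≤ (partial n + ρ) (*-monoˡ ρ (<⇒≤ (0<term (suc n))) (ratio+ratio≤1 (suc n))) ⟩
  partial n + ρ + ρ * 1ℚ                            ≡⟨ cong (_+_ (partial n + ρ)) (*-identityʳ ρ) ⟩
  partial n + ρ + ρ                                 ≡⟨ +-assoc (partial n) ρ ρ ⟩
  partial n + (ρ + ρ)                               ∎
  where
  open ≤-Reasoning
  ρ : ℚ
  ρ = term (suc n)

stepwise : ∀ {_∼_ : Rel ℚ 0ℓ} → Reflexive _∼_ → Transitive _∼_ → (f : ℕ → ℚ) →
  (∀ n → f n ∼ f (suc n)) → ∀ {m n} → m ℕ.≤ n → f m ∼ f n
stepwise {_∼_} ∼-refl ∼-trans f step m≤n = go (ℕ.≤⇒≤′ m≤n)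
  where
  go : ∀ {m n} → m ℕ.≤′ n → f m ∼ f n
  go (ℕ.≤′-reflexive refl) = ∼-refl
  go (ℕ.≤′-step m≤n)       = ∼-trans (go m≤n) (step _)

partial-mono : ∀ {m n} → m ℕ.≤ n → partial m ≤ partial n
partial-mono = stepwise {_≤_} ≤-refl ≤-trans partial partial-step

partial≤upper : ∀ {m n} → m ℕ.≤ n → partial n ≤ upper m
partial≤upper {m} {n} m≤n = ≤-trans
  (subst (_≤ upper n) (+-identityʳ (partial n))
    (+-monoʳ-≤ (partial n) (<⇒≤ (+-mono-< (0<term (suc n)) (0<term (suc n))))))
  (stepwise {flip _≤_} ≤-refl (flip ≤-trans) upper upper-step m≤n)

partial-diff : ∀ {k m n} → k ℕ.≤ m → k ℕ.≤ n → partial m - partial n ≤ term (suc k) + term (suc k)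
partial-diff {k} {m} {n} k≤m k≤n = begin
  partial m - partial n                              ≤⟨ +-mono-≤ (partial≤upper k≤m) (neg-antimono-≤ (partial-mono k≤n)) ⟩
  partial k + (term (suc k) + term (suc k)) - partial k    ≡⟨ cancel (partial k) (term (suc k) + term (suc k)) ⟩
  term (suc k) + term (suc k)                  ∎
  where
  open ≤-Reasoning
  cancel : ∀ p q → p + q - p ≡ q
  cancel = solve 2 (λ p q → p :+ q :- p := q) refl
    where open +-*-Solver

partial-cauchy : IsCauchy partial
partial-cauchy ε 0<ε with archimedean {1ℚ + 1ℚ} {ε} (+-mono-< 0<1 0<1) 0<ε
... | M , 2≤Mε = M , λ m n M≤m M≤n → ≤-<-trans (abs m n M≤m M≤n) 2term<ε
  where
  q : ℚ
  q = toℚ (+ den (suc M))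
  abs : ∀ m n → M ℕ.≤ m → M ℕ.≤ n → ∣ partial m - partial n ∣ ≤ term (suc M) + term (suc M)
  abs m n M≤m M≤n with ∣p∣≡p∨∣p∣≡-p (partial m - partial n)
  ... | inj₁ eq = subst (_≤ term (suc M) + term (suc M)) (sym eq) (partial-diff M≤m M≤n)
  ... | inj₂ eq = subst (_≤ term (suc M) + term (suc M)) (sym (trans eq (swap (partial m) (partial n)))) (partial-diff M≤n M≤m)
    where
    swap : ∀ p q → - (p - q) ≡ q - p
    swap = solve 2 (λ p q → :- (p :- q) := q :- p) refl
      where open +-*-Solver
  -- Multiplying by `den (suc M)` turns the two terms into `1 + 1`, which is at most `M * ε` and
  -- hence below `den (suc M) * ε`.
  2term<ε : term (suc M) + term (suc M) < ε
  2term<ε = *-cancelˡ-<-nonNeg q {{nonNegative (0≤toℚ (den (suc M)))}} (begin-strict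
    q * (term (suc M) + term (suc M))           ≡⟨ *-distribˡ-+ q (term (suc M)) (term (suc M)) ⟩
    q * term (suc M) + q * term (suc M)         ≡⟨ cong₂ _+_ (den*term (suc M)) (den*term (suc M)) ⟩
    1ℚ + 1ℚ                               ≤⟨ 2≤Mε ⟩
    toℚ (+ M) * ε                         <⟨ *-monoˡ-<-pos ε {{positive 0<ε}} (toℚ-mono-< {+ M} {+ den (suc M)} (ℤ.+<+ (ℕ.<-trans (ℕ.n<1+n M) (den>n (suc M))))) ⟩
    q * ε                                 ∎)
    where open ≤-Reasoning

-- The half-plane below the line of slope e - 2: LC without BPP

slanted : HalfPlane
slanted = record { a = mkℝ partial partial-cauchy ; b = fromℤ -[1+ 0 ] ; c = 0ᴿ ; nondegenerate = inj₂ (≢0⇒# { -[1+ 0 ] } λ ()) }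

inside-slanted : ∀ {ε} → 0ℚ < ε → ∀ A → Eventually (λ n → ε ≤ value slanted n A) → ι A ∈ Inside slanted
inside-slanted {ε} 0<ε A@(_ , _) ε≤ = ε , 0<ε ,
  eventually-map (λ n → subst (_≤ value slanted n A) (sym (+-identityˡ ε))) ε≤

irrational : StepSet
irrational = record
  { Step   = λ A → ι A ∈ Inside slanted
  ; O∉Step = λ O∈ → let ε , 0<ε , ε≤ = boundary-inside slanted O (form-O≃0ᴿ slanted) O∈
                        n , ε≤0 = eventually⇒∃ ε≤
                    in <-irrefl refl (<-≤-trans 0<ε (subst (ε ≤_) (value-O slanted n) ε≤0)) }

irrational-LC : LC irrational
irrational-LC = slanted , form-O≃0ᴿ slanted , λ _ A∈ → A∈

linear-· : ∀ a b k A → linear a b (k · A) ≡ toℚ k * linear a b A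
linear-· a b k (x , y) = trans (cong₂ (λ s t → a * s + b * t) (toℚ-* k x) (toℚ-* k y))
  (regroup a b (toℚ k) (toℚ x) (toℚ y))
  where
  regroup : ∀ a b k x y → a * (k * x) + b * (k * y) ≡ k * (a * x + b * y)
  regroup = solve 5 (λ a b k x y → a :* (k :* x) :+ b :* (k :* y) := k :* (a :* x :+ b :* y)) refl
    where open +-*-Solver

-- The form is exactly 1 here; this is the amount that arbitrarily many convergent steps will share.
target : ℤ²
target = 0ℤ , -[1+ 0 ]

value-target : ∀ n → value slanted n target ≡ 1ℚ
value-target n = cong (_+ 1ℚ) (*-zeroʳ (partial n))

convergent : ℕ → ℤ²
convergent n = + den n , + num n

value-convergent : ∀ n m → value slanted m (convergent n) ≡ toℚ (+ den n) * (partial m - partial n)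
value-convergent n m = trans (cong (λ t → partial m * toℚ (+ den n) + (- 1ℚ) * t) (num≡den*partial n))
  (regroup (partial m) (partial n) (toℚ (+ den n)))
  where
  regroup : ∀ s t q → s * q + (- 1ℚ) * (q * t) ≡ q * (s - t)
  regroup = solve 3 (λ s t q → s :* q :+ con (- 1ℚ) :* (q :* t) := q :* (s :- t)) refl
    where open +-*-Solver

den*term-suc : ∀ n → toℚ (+ den n) * term (suc n) ≡ ratio n
den*term-suc n = trans (sym (*-assoc (toℚ (+ den n)) (term n) (ratio n)))
  (trans (cong (_* ratio n) (den*term n)) (*-identityˡ (ratio n)))

-- The value of a convergent is `den n` times the rest of the series, whose first term alone
-- contributes (n+1)!/(n+2)! = 1/(n+2).
ratio≤convergent : ∀ n m → suc n ℕ.≤ m → ratio n ≤ value slanted m (convergent n)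
ratio≤convergent n m n<m = begin
  ratio n                                 ≡⟨ sym (den*term-suc n) ⟩
  toℚ (+ den n) * term (suc n)             ≡⟨ cong (toℚ (+ den n) *_) (cancel (partial n) (term (suc n))) ⟩
  toℚ (+ den n) * (partial (suc n) - partial n)     ≤⟨ *-monoˡ (toℚ (+ den n)) (0≤toℚ (den n)) (+-monoˡ-≤ (- partial n) (partial-mono n<m)) ⟩
  toℚ (+ den n) * (partial m - partial n)           ≡⟨ sym (value-convergent n m) ⟩
  value slanted m (convergent n)      ∎
  where
  open ≤-Reasoning
  cancel : ∀ p q → q ≡ p + q - p
  cancel = solve 2 (λ p q → q := p :+ q :- p) refl
    where open +-*-Solver

convergent≤2ratio : ∀ n m → n ℕ.≤ m → value slanted m (convergent n) ≤ ratio n + ratio n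
convergent≤2ratio n m n≤m = begin
  value slanted m (convergent n)            ≡⟨ value-convergent n m ⟩
  toℚ (+ den n) * (partial m - partial n)                 ≤⟨ *-monoˡ (toℚ (+ den n)) (0≤toℚ (den n)) (partial-diff n≤m ℕ.≤-refl) ⟩
  toℚ (+ den n) * (term (suc n) + term (suc n))     ≡⟨ *-distribˡ-+ (toℚ (+ den n)) (term (suc n)) (term (suc n)) ⟩
  toℚ (+ den n) * term (suc n) + toℚ (+ den n) * term (suc n) ≡⟨ cong₂ _+_ (den*term-suc n) (den*term-suc n) ⟩
  ratio n + ratio n                                 ∎
  where open ≤-Reasoning

remainder : ℕ → ℤ²
remainder k = (ℤ.- + k) · convergent (k ℕ.+ k) ⊕ target

-- At index `2 k` each of the `k` convergents uses at most `2/(2k+2)` of the value 1 of `target`,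
-- together `k/(k+1)`. At least `1/(k+1)` is left, which is twice `ratio (k + k)`.
ratio≤remainder : ∀ k m → k ℕ.+ k ℕ.≤ m → ratio (k ℕ.+ k) ≤ value slanted m (remainder k)
ratio≤remainder k m 2k≤m = begin
  υ                                      ≡⟨ sym (+-identityʳ υ) ⟩
  υ + 0ℚ                                 ≤⟨ +-monoʳ-≤ υ (<⇒≤ (0<ratio n)) ⟩
  υ + υ                                  ≡⟨ regroup κ υ ⟩
  - κ * (υ + υ) + (1ℚ + 1ℚ + (κ + κ)) * υ ≡⟨ cong (λ t → - κ * (υ + υ) + t * υ) (sym suc-suc) ⟩
  - κ * (υ + υ) + toℚ (+ suc (suc n)) * υ ≡⟨ cong (_+_ (- κ * (υ + υ))) (ratio-inverse n) ⟩
  - κ * (υ + υ) + 1ℚ                     ≡⟨ cong (_+ 1ℚ) (sym (neg-distribˡ-* κ (υ + υ))) ⟩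
  - (κ * (υ + υ)) + 1ℚ                   ≤⟨ +-monoˡ-≤ 1ℚ (neg-antimono-≤ (*-monoˡ κ (0≤toℚ k) (convergent≤2ratio n m 2k≤m))) ⟩
  - (κ * value slanted m (convergent n)) + 1ℚ   ≡⟨ cong (_+ 1ℚ) (neg-distribˡ-* κ _) ⟩
  - κ * value slanted m (convergent n) + 1ℚ     ≡⟨ cong₂ (λ s t → s * value slanted m (convergent n) + t) (sym (toℚ-neg (+ k))) (sym (value-target m)) ⟩
  toℚ (ℤ.- + k) * value slanted m (convergent n) + value slanted m target
    ≡⟨ cong (_+ value slanted m target) (sym (linear-· (partial m) (- 1ℚ) (ℤ.- + k) (convergent n))) ⟩
  value slanted m ((ℤ.- + k) · convergent n) + value slanted m target
    ≡⟨ sym (value-⊕ slanted m ((ℤ.- + k) · convergent n) target) ⟩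
  value slanted m (remainder k)          ∎
  where
  open ≤-Reasoning
  n : ℕ
  n = k ℕ.+ k
  υ κ : ℚ
  υ = ratio n
  κ = toℚ (+ k)
  suc-suc : toℚ (+ suc (suc n)) ≡ 1ℚ + 1ℚ + (κ + κ)
  suc-suc = trans (toℚ-+ (+ 2) (+ n)) (cong (_+_ (1ℚ + 1ℚ)) (toℚ-+ (+ k) (+ k)))
  regroup : ∀ κ υ → υ + υ ≡ - κ * (υ + υ) + (1ℚ + 1ℚ + (κ + κ)) * υ
  regroup = solve 2 (λ κ υ → υ :+ υ := :- κ :* (υ :+ υ) :+ (con 1ℚ :+ con 1ℚ :+ (κ :+ κ)) :* υ) refl
    where open +-*-Solver

-- Since `remainder k` is itself a step, it completes `k` convergents to a path of length `k + 1` to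
-- the fixed point `target`.
irrational-¬BPP : ¬ BPP irrational
irrational-¬BPP bpp = unbounded⇒Infinite id
  (λ k → let n = k ℕ.+ k ; w = remainder k ∷ replicate k (convergent n) in
     length w
   , ( w
     , ( inside-slanted (0<ratio n) (remainder k) (n , ratio≤remainder k)
         ∷ All.replicate⁺ k (inside-slanted (0<ratio n) (convergent n) (suc n , ratio≤convergent n))
       , trans (cong (remainder k ⊕_) (α-replicate k (convergent n))) (cancel (+ k) (convergent n) target))
     , refl)
   , ℕ.≤-trans (ℕ.≤-reflexive (sym (length-replicate k))) (ℕ.n≤1+n _))
  (bpp target (gen (inside-slanted 0<1 target (0 , λ n _ → ≤-reflexive (sym (value-target n))))))
  where
  cancel : ∀ k A B → ((ℤ.- k) · A ⊕ B) ⊕ k · A ≡ B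
  cancel k (x , y) (z , w) = cong₂ _,_ (lemma k x z) (lemma k y w)
    where
    lemma : ∀ k x z → ((ℤ.- k) ℤ.* x ℤ.+ z) ℤ.+ k ℤ.* x ≡ z
    lemma = solve-∀

-- The implications out of CC, and the assembly of all three claims

CC⇒SLC : ∀ X → CC X → SLC X
CC⇒SLC X cc = coercive⇒SLC X (CC⇒coercive X cc)

CC⇒FPP : ∀ X → CC X → FPP X
CC⇒FPP X cc = coercive⇒FPP X (CC⇒coercive X cc)

theorem2p27 : ((X : StepSet) →
    (CC X → SLC X)
    × (SLC X → LC X)
    × (FPP X → BPP X)
    × (BPP X → ¬ IPP X)
    × (CC X → FPP X)
    × (SLC X → BPP X)
    × (LC X → ¬ IPP X))
    × ((X : StepSet) → Finite (Step X) →
    (CC X ⇔ SLC X)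
    × (SLC X ⇔ LC X)
    × (FPP X ⇔ BPP X)
    × (BPP X ⇔ (¬ IPP X))
    × (CC X ⇔ FPP X)
    × (SLC X ⇔ BPP X)
    × (LC X ⇔ (¬ IPP X)))
    × (  (Σ[ X ∈ StepSet ] (SLC X × ¬ CC X))
    × (Σ[ X ∈ StepSet ] (LC X × ¬ SLC X))
    × (Σ[ X ∈ StepSet ] (BPP X × ¬ FPP X))
    × (Σ[ X ∈ StepSet ] (¬ IPP X × ¬ BPP X))
    × (Σ[ X ∈ StepSet ] (FPP X × ¬ CC X))
    × (Σ[ X ∈ StepSet ] (BPP X × ¬ SLC X))
    × (Σ[ X ∈ StepSet ] (¬ IPP X × ¬ LC X)))
theorem2p27 =
    (λ X → CC⇒SLC X , SLC⇒LC X , FPP⇒BPP X , BPP⇒¬IPP X , CC⇒FPP X , SLC⇒BPP X , LC⇒¬IPP X)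
  , (λ X finite →
      -- Every converse passes through this implication: each condition yields ¬IPP in general, and
      -- CC yields each condition.
      let ¬IPP⇒CC  = λ (¬ipp : ¬ IPP X) → coercive⇒CC X (finite∧¬IPP⇒coercive {X} finite ¬ipp)
          ¬IPP⇒SLC = λ (¬ipp : ¬ IPP X) → CC⇒SLC X (¬IPP⇒CC ¬ipp)
          ¬IPP⇒FPP = λ (¬ipp : ¬ IPP X) → CC⇒FPP X (¬IPP⇒CC ¬ipp)
          FPP⇒¬IPP = λ (fpp : FPP X) → BPP⇒¬IPP X (FPP⇒BPP X fpp)
      in mk⇔ (CC⇒SLC X) (λ slc → ¬IPP⇒CC (BPP⇒¬IPP X (SLC⇒BPP X slc)))
       , mk⇔ (SLC⇒LC X) (λ lc → ¬IPP⇒SLC (LC⇒¬IPP X lc))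
       , mk⇔ (FPP⇒BPP X) (λ bpp → ¬IPP⇒FPP (BPP⇒¬IPP X bpp))
       , mk⇔ (BPP⇒¬IPP X) (λ ¬ipp → FPP⇒BPP X (¬IPP⇒FPP ¬ipp))
       , mk⇔ (CC⇒FPP X) (λ fpp → ¬IPP⇒CC (FPP⇒¬IPP fpp))
       , mk⇔ (SLC⇒BPP X) (λ bpp → ¬IPP⇒SLC (BPP⇒¬IPP X bpp))
       , mk⇔ (LC⇒¬IPP X) (λ ¬ipp → SLC⇒LC X (¬IPP⇒SLC ¬ipp)))
  -- Three sets settle seven converses, because failing a consequence of a condition refutes the
  -- condition itself.
  , (horizontal , horizontal-SLC , horizontal-¬FPP ∘ CC⇒FPP horizontal)
  , (irrational , irrational-LC , irrational-¬BPP ∘ SLC⇒BPP irrational)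
  , (horizontal , SLC⇒BPP horizontal horizontal-SLC , horizontal-¬FPP)
  , (irrational , LC⇒¬IPP irrational irrational-LC , irrational-¬BPP)
  , (parabola , parabola-FPP , parabola-¬LC ∘ SLC⇒LC parabola ∘ CC⇒SLC parabola)
  , (parabola , parabola-BPP , parabola-¬LC ∘ SLC⇒LC parabola)
  , (parabola , BPP⇒¬IPP parabola parabola-BPP , parabola-¬LC)
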